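{- (i) Let $S\equiv\pm\{1, 4, 5, 6, 7, 9, 15, 17, 19, 20, 22, 23\}\pmod{48}$ and $T\equiv\pm\{1, 3, 4, 5, 11, 13, 14, 18, 19, 20, 21, 23\}\pmod{48}$. Then $p(S,n)=p(T,n-1)$ for all $n\geq 1$. (ii) Let $S\equiv\pm\{2, 3, 4, 5, 7, 11, 13, 17, 18, 19, 20, 21\}\pmod{48}$ and $T\equiv\pm\{1, 4, 6, 7, 9, 10, 11, 13, 15, 17, 20, 23\}\pmod{48}$. Then $p(S,n)=p(T,n)$ for all integers $n\ge0$ with $n\neq 1$.
   Context: For a set $S$ of positive integers and an integer $n\ge 0$, $p(S,n)$ denotes the number of partitions of $n$ into parts belonging to $S$ (so $p(S,0)=1$). The notation $S\equiv\pm\{r_1,\dots,r_k\}\pmod M$ means that $S$ is the set of all positive integers $n$ such that $n\equiv r_i$ or $n\equiv -r_i\pmod M$ for some $i$. -}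

module Defs where

open import Data.Nat using (ℕ; zero; suc; _+_; _*_; _∸_; _%_)
open import Data.Nat.Properties using (_≟_)
open import Data.Bool using (Bool; true; false; if_then_else_; _∨_)
open import Data.List using (List; _∷_; [])
open import Data.Bool.ListAction using (any)
open import Relation.Nullary.Decidable using (⌊_⌋)

-- A set S of positive integers, given by its (decidable) characteristic
-- function on ℕ.  Membership of 0 is ignored: parts are always ≥ 1.
PartSet : Set
PartSet = ℕ → Bool

sumUpTo : ℕ → (ℕ → ℕ) → ℕ
sumUpTo zero    f = f 0
sumUpTo (suc m) f = sumUpTo m f + f (suc m)

-- pBounded S k n = number of partitions of n into parts that belong to S
-- and are ≤ k.  Recursion on k: choose multiplicity j of the part k
-- (j = 0 if k ∉ S), remaining n ∸ j*k partitioned into parts ≤ k-1.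
pBounded : PartSet → ℕ → ℕ → ℕ
pBounded S zero    zero    = 1
pBounded S zero    (suc n) = 0
pBounded S (suc k) n with S (suc k)
... | false = pBounded S k n
... | true  = sumUpTo n (λ j → if ⌊ suc k * j Data.Nat.≤? n ⌋
                                  then pBounded S k (n ∸ suc k * j)
                                  else 0)

-- p(S,n): number of partitions of n into parts belonging to S
-- (every part of a partition of n is ≤ n).  p(S,0) = 1.
p : PartSet → ℕ → ℕ
p S n = pBounded S n n

-- S ≡ ±{r₁,…,r_k} (mod M): the positive integers n with n ≡ ±rᵢ (mod M)
-- for some i.  Since rᵢ < M here, n ≡ -rᵢ means n % M ≡ M ∸ rᵢ.
-- (Membership of 0 is irrelevant, parts are positive.)
pmResidues : (M : ℕ) → List ℕ → PartSet
pmResidues zero    rs n = false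
pmResidues (suc m) rs n =
  any (λ r → ⌊ n % suc m ≟ r % suc m ⌋ ∨ ⌊ n % suc m ≟ (suc m ∸ r % suc m) % suc m ⌋) rs

module Submission where

-- Write [r] = (q^r, q^(24-r); q^24)_∞ and {r} = (-q^r, -q^(24-r); q^24)_∞.  Since {r}[r] = (q^(2r), q^(48-2r); q^48)_∞,
-- clearing denominators turns the two generating function identities
--   1/∏_S (1 - q^s) - q/∏_T (1 - q^s) = 1   and   1/∏_T (1 - q^s) - 1/∏_S (1 - q^s) = q
-- into the four-theta relations
--   {1}{5}{7}{9} = q{1}{3}{5}{11} + [2][4][6][10]   and   {3}{5}{7}{11} + q[2][4][6][10] = {1}{7}{9}{11}.
-- By the Jacobi triple product every factor is, up to a common unit, a series ∑ s^k q^(12k² + ck).  Splitting (k , l) by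
-- the parity of k + l expands a product of two such series as a 2 × 2 minor in series ∑ q^(24k² + mk), and the
-- four-theta relations become Plücker relations between minors.
-- All this happens in a commutative semiring with a nilpotent q and an element t with 1 + t = 0, where infinite
-- sums and products are finite.
open import Defs
open import Algebra using (CommutativeSemiring)
open import Algebra.Structures.Biased using (isCommutativeMonoidˡ; isCommutativeSemiringˡ)
open import Data.Bool using (true; false; if_then_else_; _∨_)
open import Data.Bool.ListAction using (any)
open import Data.Integer as ℤ using (ℤ; +_; -[1+_]; _⊖_; ∣_∣)
import Data.Integer.Properties as ℤ
import Data.Integer.Tactic.RingSolver as ℤ-RingSolver
open import Data.List using (List; _∷_; []; foldr; filterᵇ; applyDownFrom)
open import Data.Nat as ℕ using (ℕ; zero; suc; z≤n; s≤s; _≤?_)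
open import Data.Nat.DivMod using ([m+kn]%n≡m%n)
import Data.Nat.Properties as ℕ
import Data.Nat.Tactic.RingSolver as ℕ-RingSolver
open import Data.Product using (_×_; _,_; ∃)
open import Data.Sum using (inj₁; inj₂)
open import Level using (0ℓ)
open import Relation.Binary using (IsEquivalence; Setoid)
open import Relation.Binary.PropositionalEquality as ≡ using (_≡_; _≢_)
open import Relation.Nullary using (yes; no; contradiction)
open import Relation.Nullary.Decidable using (⌊_⌋)
open import Algebra.Properties.AbelianGroup ℤ.+-0-abelianGroup using (∙-cancelʳ)
open import Algebra.Properties.CommutativeSemigroup ℤ.+-commutativeSemigroup using (interchange)

-- Exponents of theta series

-- Why minors appear: put c = 12 - r for a factor with index r. Multiplying the factors with
-- parameters c and d gives an even part built from the series ∑ q^(24k² + mk) with m = c + d and m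
-- = d - c, and an odd part built from those with m = 24 - (c + d) and m = 24 - (d - c); the sign of
-- m is immaterial because k may be replaced by -k. So the series come in pairs {m , 24 - m}, each
-- pair is a column, and a product of two factors is a minor of two columns. Only four columns
-- occur: {10 , 14}, {4 , 20}, {6 , 18} and {8 , 16}. For instance {9}{5} has c = 3, d = 7, hence
-- the columns {10 , 14} and {4 , 20}. The three products in each four-theta relation are the three
-- ways of splitting the four columns into two pairs; this is why the factors {1}{5}, respectively
-- {7}{11}, shared by two terms are kept rather than cancelled.

tri : ℕ → ℕ
tri zero    = 0
tri (suc n) = suc n ℕ.+ tri n

-- T k = k (k + 1) / 2 for every integer k.
T : ℤ → ℕ
T (+ n)    = tri n
T -[1+ n ] = tri n

n≤tri[n] : ∀ n → n ℕ.≤ tri n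
n≤tri[n] zero    = z≤n
n≤tri[n] (suc n) = ℕ.m≤m+n (suc n) (tri n)

2*tri : ∀ n → 2 ℕ.* tri n ≡ n ℕ.* n ℕ.+ n
2*tri zero    = ≡.refl
2*tri (suc n) = begin
  2 ℕ.* (suc n ℕ.+ tri n)          ≡⟨ ℕ.*-distribˡ-+ 2 (suc n) (tri n) ⟩
  2 ℕ.* suc n ℕ.+ 2 ℕ.* tri n      ≡⟨ ≡.cong (2 ℕ.* suc n ℕ.+_) (2*tri n) ⟩
  2 ℕ.* suc n ℕ.+ (n ℕ.* n ℕ.+ n)  ≡⟨ lemma n ⟩
  suc n ℕ.* suc n ℕ.+ suc n        ∎
  where
  open ≡.≡-Reasoning
  lemma : ∀ n → 2 ℕ.* suc n ℕ.+ (n ℕ.* n ℕ.+ n) ≡ suc n ℕ.* suc n ℕ.+ suc n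
  lemma = ℕ-RingSolver.solve-∀

-- m = z / 2.  Identities between values of T are checked in ℤ after doubling, where they are polynomial.
record Half (m : ℕ) (z : ℤ) : Set where
  constructor half
  field double : + 2 ℤ.* + m ≡ z

open Half

half-unique : ∀ {m n y z} → Half m y → Half n z → y ≡ z → m ≡ n
half-unique {m} {n} p q y≡z =
  ℤ.+-injective (ℤ.*-cancelˡ-≡ (+ 2) (+ m) (+ n) (≡.trans (double p) (≡.trans y≡z (≡.sym (double q)))))

half-2* : ∀ n → Half n (+ 2 ℤ.* + n)
half-2* n = half ≡.refl

infixl 6 _⊞_
_⊞_ : ∀ {m n y z} → Half m y → Half n z → Half (m ℕ.+ n) (y ℤ.+ z)
_⊞_ {m} {n} p q = half (≡.trans (ℤ.*-distribˡ-+ (+ 2) (+ m) (+ n)) (≡.cong₂ ℤ._+_ (double p) (double q)))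

half-* : ∀ a {m z} → Half m z → Half (a ℕ.* m) (+ a ℤ.* z)
half-* a {m} {z} p = half (begin
  + 2 ℤ.* + (a ℕ.* m)      ≡⟨ ≡.cong (+ 2 ℤ.*_) (ℤ.pos-* a m) ⟩
  + 2 ℤ.* (+ a ℤ.* + m)    ≡⟨ lemma (+ a) (+ m) ⟩
  + a ℤ.* (+ 2 ℤ.* + m)    ≡⟨ ≡.cong (+ a ℤ.*_) (double p) ⟩
  + a ℤ.* z                ∎)
  where
  open ≡.≡-Reasoning
  lemma : ∀ a m → + 2 ℤ.* (a ℤ.* m) ≡ a ℤ.* (+ 2 ℤ.* m)
  lemma = ℤ-RingSolver.solve-∀

half-T : ∀ k → Half (T k) (k ℤ.* k ℤ.+ k)
half-T (+ n) = half (begin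
  + 2 ℤ.* + tri n      ≡⟨ ℤ.pos-* 2 (tri n) ⟨
  + (2 ℕ.* tri n)      ≡⟨ ≡.cong +_ (2*tri n) ⟩
  + (n ℕ.* n) ℤ.+ + n  ≡⟨ ≡.cong (ℤ._+ + n) (ℤ.pos-* n n) ⟩
  + n ℤ.* + n ℤ.+ + n  ∎)
  where open ≡.≡-Reasoning
half-T -[1+ n ] = half (begin
  + 2 ℤ.* + tri n      ≡⟨ ℤ.pos-* 2 (tri n) ⟨
  + (2 ℕ.* tri n)      ≡⟨ ≡.cong +_ (2*tri n) ⟩
  + (n ℕ.* n) ℤ.+ + n  ≡⟨ ≡.cong (ℤ._+ + n) (ℤ.pos-* n n) ⟩
  + n ℤ.* + n ℤ.+ + n  ≡⟨ lemma (+ n) ⟩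
  k ℤ.* k ℤ.+ k        ∎)
  where
  open ≡.≡-Reasoning
  k = ℤ.- (+ 1 ℤ.+ + n)
  lemma : ∀ x → x ℤ.* x ℤ.+ x ≡ (ℤ.- (+ 1 ℤ.+ x)) ℤ.* (ℤ.- (+ 1 ℤ.+ x)) ℤ.+ (ℤ.- (+ 1 ℤ.+ x))
  lemma = ℤ-RingSolver.solve-∀

-- This is (a + b) k² / 2 + (b - a) k / 2, arranged so that no subtraction or division is needed.
thetaExp : ℕ → ℕ → ℤ → ℕ
thetaExp a b k = a ℕ.* T (ℤ.- k) ℕ.+ b ℕ.* T k

half-thetaExp : ∀ a b k → Half (thetaExp a b k)
  (+ a ℤ.* ((ℤ.- k) ℤ.* (ℤ.- k) ℤ.+ (ℤ.- k)) ℤ.+ + b ℤ.* (k ℤ.* k ℤ.+ k))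
half-thetaExp a b k = half-* a (half-T (ℤ.- k)) ⊞ half-* b (half-T k)

-- The parameters e, h, g keep all exponents natural: they stand for two series ∑ q^(A k² + c k), ∑ q^(A k² + d k)
-- with A = e + (g + h) / 2, c = (g - h) / 2 and d = (g + h) / 2.
thetaExp-even : ∀ e h g i j →
  thetaExp (e ℕ.+ h) (e ℕ.+ g) (i ℤ.+ j) ℕ.+ thetaExp e (e ℕ.+ h ℕ.+ g) (i ℤ.- j)
  ≡ thetaExp (e ℕ.+ e ℕ.+ h) (e ℕ.+ e ℕ.+ h ℕ.+ g ℕ.+ g) i
      ℕ.+ thetaExp (e ℕ.+ e ℕ.+ h ℕ.+ h ℕ.+ g) (e ℕ.+ e ℕ.+ g) j
thetaExp-even e h g i j = half-unique
  (half-thetaExp (e ℕ.+ h) (e ℕ.+ g) (i ℤ.+ j) ⊞ half-thetaExp e (e ℕ.+ h ℕ.+ g) (i ℤ.- j))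
  (half-thetaExp (e ℕ.+ e ℕ.+ h) (e ℕ.+ e ℕ.+ h ℕ.+ g ℕ.+ g) i
    ⊞ half-thetaExp (e ℕ.+ e ℕ.+ h ℕ.+ h ℕ.+ g) (e ℕ.+ e ℕ.+ g) j)
  (lemma (+ e) (+ h) (+ g) i j)
  where
  lemma : ∀ e h g i j →
    (e ℤ.+ h) ℤ.* ((ℤ.- (i ℤ.+ j)) ℤ.* (ℤ.- (i ℤ.+ j)) ℤ.+ (ℤ.- (i ℤ.+ j))) ℤ.+ (e ℤ.+ g) ℤ.* ((i ℤ.+ j) ℤ.* (i ℤ.+ j) ℤ.+ (i ℤ.+ j))
      ℤ.+ (e ℤ.* ((ℤ.- (i ℤ.- j)) ℤ.* (ℤ.- (i ℤ.- j)) ℤ.+ (ℤ.- (i ℤ.- j))) ℤ.+ (e ℤ.+ h ℤ.+ g) ℤ.* ((i ℤ.- j) ℤ.* (i ℤ.- j) ℤ.+ (i ℤ.- j)))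
    ≡ (e ℤ.+ e ℤ.+ h) ℤ.* ((ℤ.- i) ℤ.* (ℤ.- i) ℤ.+ (ℤ.- i)) ℤ.+ (e ℤ.+ e ℤ.+ h ℤ.+ g ℤ.+ g) ℤ.* (i ℤ.* i ℤ.+ i)
      ℤ.+ ((e ℤ.+ e ℤ.+ h ℤ.+ h ℤ.+ g) ℤ.* ((ℤ.- j) ℤ.* (ℤ.- j) ℤ.+ (ℤ.- j)) ℤ.+ (e ℤ.+ e ℤ.+ g) ℤ.* (j ℤ.* j ℤ.+ j))
  lemma = ℤ-RingSolver.solve-∀

-- Here k = i + j and l = i - j - 1, so k + l = 2i - 1. The substitution leaves the constant A - d =
-- e, which becomes the factor q^e in front of the odd part.
thetaExp-odd : ∀ e h g i j →
  thetaExp (e ℕ.+ h) (e ℕ.+ g) (i ℤ.+ j) ℕ.+ thetaExp e (e ℕ.+ h ℕ.+ g) (ℤ.- (+ 1) ℤ.+ (i ℤ.- j))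
  ≡ e ℕ.+ (thetaExp (e ℕ.+ e ℕ.+ e ℕ.+ e ℕ.+ h ℕ.+ h ℕ.+ g) g i
      ℕ.+ thetaExp h (e ℕ.+ e ℕ.+ e ℕ.+ e ℕ.+ h ℕ.+ g ℕ.+ g) j)
thetaExp-odd e h g i j = half-unique
  (half-thetaExp (e ℕ.+ h) (e ℕ.+ g) (i ℤ.+ j) ⊞ half-thetaExp e (e ℕ.+ h ℕ.+ g) (ℤ.- (+ 1) ℤ.+ (i ℤ.- j)))
  (half-2* e ⊞ (half-thetaExp (e ℕ.+ e ℕ.+ e ℕ.+ e ℕ.+ h ℕ.+ h ℕ.+ g) g i
    ⊞ half-thetaExp h (e ℕ.+ e ℕ.+ e ℕ.+ e ℕ.+ h ℕ.+ g ℕ.+ g) j))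
  (lemma (+ e) (+ h) (+ g) i j)
  where
  lemma : ∀ e h g i j →
    (e ℤ.+ h) ℤ.* ((ℤ.- (i ℤ.+ j)) ℤ.* (ℤ.- (i ℤ.+ j)) ℤ.+ (ℤ.- (i ℤ.+ j))) ℤ.+ (e ℤ.+ g) ℤ.* ((i ℤ.+ j) ℤ.* (i ℤ.+ j) ℤ.+ (i ℤ.+ j))
      ℤ.+ (e ℤ.* ((ℤ.- (ℤ.- (+ 1) ℤ.+ (i ℤ.- j))) ℤ.* (ℤ.- (ℤ.- (+ 1) ℤ.+ (i ℤ.- j))) ℤ.+ (ℤ.- (ℤ.- (+ 1) ℤ.+ (i ℤ.- j)))) ℤ.+ (e ℤ.+ h ℤ.+ g) ℤ.* ((ℤ.- (+ 1) ℤ.+ (i ℤ.- j)) ℤ.* (ℤ.- (+ 1) ℤ.+ (i ℤ.- j)) ℤ.+ (ℤ.- (+ 1) ℤ.+ (i ℤ.- j))))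
    ≡ + 2 ℤ.* e ℤ.+ ((e ℤ.+ e ℤ.+ e ℤ.+ e ℤ.+ h ℤ.+ h ℤ.+ g) ℤ.* ((ℤ.- i) ℤ.* (ℤ.- i) ℤ.+ (ℤ.- i)) ℤ.+ g ℤ.* (i ℤ.* i ℤ.+ i)
      ℤ.+ (h ℤ.* ((ℤ.- j) ℤ.* (ℤ.- j) ℤ.+ (ℤ.- j)) ℤ.+ (e ℤ.+ e ℤ.+ e ℤ.+ e ℤ.+ h ℤ.+ g ℤ.+ g) ℤ.* (j ℤ.* j ℤ.+ j)))
  lemma = ℤ-RingSolver.solve-∀

-- signExp k = k², which has the parity of k.
signExp : ℤ → ℕ
signExp k = T (ℤ.- k) ℕ.+ T k

half-signExp : ∀ k → Half (signExp k) (+ 2 ℤ.* (k ℤ.* k))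
half-signExp k = half (≡.trans (double (half-T (ℤ.- k) ⊞ half-T k)) (lemma k))
  where
  lemma : ∀ k → (ℤ.- k) ℤ.* (ℤ.- k) ℤ.+ (ℤ.- k) ℤ.+ (k ℤ.* k ℤ.+ k) ≡ + 2 ℤ.* (k ℤ.* k)
  lemma = ℤ-RingSolver.solve-∀

signExp-even : ∀ i j → let n = signExp i ℕ.+ signExp j in
  signExp (i ℤ.+ j) ℕ.+ signExp (i ℤ.- j) ≡ n ℕ.+ n
signExp-even i j = half-unique (half-signExp (i ℤ.+ j) ⊞ half-signExp (i ℤ.- j)) (n ⊞ n) (lemma i j)
  where
  n = half-signExp i ⊞ half-signExp j
  lemma : ∀ i j → + 2 ℤ.* ((i ℤ.+ j) ℤ.* (i ℤ.+ j)) ℤ.+ + 2 ℤ.* ((i ℤ.- j) ℤ.* (i ℤ.- j))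
    ≡ + 2 ℤ.* (i ℤ.* i) ℤ.+ + 2 ℤ.* (j ℤ.* j) ℤ.+ (+ 2 ℤ.* (i ℤ.* i) ℤ.+ + 2 ℤ.* (j ℤ.* j))
  lemma = ℤ-RingSolver.solve-∀

-- The sum of the two squares is odd, so for s² = 1 exactly one factor s survives in the odd part;
-- in the even part none does.
signExp-odd : ∀ i j → let m = T (ℤ.- i) ℕ.+ T j ; n = m ℕ.+ m in
  signExp (i ℤ.+ j) ℕ.+ signExp (ℤ.- (+ 1) ℤ.+ (i ℤ.- j)) ≡ suc (n ℕ.+ n)
signExp-odd i j = half-unique
  (half-signExp (i ℤ.+ j) ⊞ half-signExp (ℤ.- (+ 1) ℤ.+ (i ℤ.- j)))
  (half-2* 1 ⊞ (n ⊞ n))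
  (lemma i j)
  where
  m = half-T (ℤ.- i) ⊞ half-T j
  n = m ⊞ m
  lemma : ∀ i j → + 2 ℤ.* ((i ℤ.+ j) ℤ.* (i ℤ.+ j)) ℤ.+ + 2 ℤ.* ((ℤ.- (+ 1) ℤ.+ (i ℤ.- j)) ℤ.* (ℤ.- (+ 1) ℤ.+ (i ℤ.- j)))
    ≡ + 2 ℤ.* + 1 ℤ.+ ((ℤ.- i) ℤ.* (ℤ.- i) ℤ.+ (ℤ.- i) ℤ.+ (j ℤ.* j ℤ.+ j) ℤ.+ ((ℤ.- i) ℤ.* (ℤ.- i) ℤ.+ (ℤ.- i) ℤ.+ (j ℤ.* j ℤ.+ j))
      ℤ.+ ((ℤ.- i) ℤ.* (ℤ.- i) ℤ.+ (ℤ.- i) ℤ.+ (j ℤ.* j ℤ.+ j) ℤ.+ ((ℤ.- i) ℤ.* (ℤ.- i) ℤ.+ (ℤ.- i) ℤ.+ (j ℤ.* j ℤ.+ j))))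
  lemma = ℤ-RingSolver.solve-∀

half-T-⊖ : ∀ j n → Half (T (j ⊖ n)) ((+ j ℤ.- + n) ℤ.* (+ j ℤ.- + n) ℤ.+ (+ j ℤ.- + n))
half-T-⊖ j n rewrite ≡.sym (ℤ.m-n≡m⊖n j n) = half-T (+ j ℤ.- + n)

half-T-neg-⊖ : ∀ j n → Half (T (ℤ.- (j ⊖ n))) ((+ n ℤ.- + j) ℤ.* (+ n ℤ.- + j) ℤ.+ (+ n ℤ.- + j))
half-T-neg-⊖ j n rewrite ≡.sym (ℤ.⊖-swap n j) = half-T-⊖ n j

-- Neighbouring theta terms with indices j - n - 1 and j - n have ratio u (u v)^(n - j). Moving j to
-- the other side keeps all exponents natural; this is the exponent of u, and `T-predʳ` that of v.
T-predˡ : ∀ j n → j ℕ.+ T (ℤ.- (j ⊖ suc n)) ≡ suc n ℕ.+ T (ℤ.- (j ⊖ n))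
T-predˡ j n = half-unique
  (half-2* j ⊞ half-T-neg-⊖ j (suc n)) (half-2* (suc n) ⊞ half-T-neg-⊖ j n) (lemma (+ j) (+ n))
  where
  lemma : ∀ j n → + 2 ℤ.* j ℤ.+ (((+ 1 ℤ.+ n) ℤ.- j) ℤ.* ((+ 1 ℤ.+ n) ℤ.- j) ℤ.+ ((+ 1 ℤ.+ n) ℤ.- j))
                ≡ + 2 ℤ.* (+ 1 ℤ.+ n) ℤ.+ ((n ℤ.- j) ℤ.* (n ℤ.- j) ℤ.+ (n ℤ.- j))
  lemma = ℤ-RingSolver.solve-∀

T-predʳ : ∀ j n → j ℕ.+ T (j ⊖ suc n) ≡ n ℕ.+ T (j ⊖ n)
T-predʳ j n = half-unique (half-2* j ⊞ half-T-⊖ j (suc n)) (half-2* n ⊞ half-T-⊖ j n) (lemma (+ j) (+ n))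
  where
  lemma : ∀ j n → + 2 ℤ.* j ℤ.+ ((j ℤ.- (+ 1 ℤ.+ n)) ℤ.* (j ℤ.- (+ 1 ℤ.+ n)) ℤ.+ (j ℤ.- (+ 1 ℤ.+ n)))
                ≡ + 2 ℤ.* n ℤ.+ ((j ℤ.- n) ℤ.* (j ℤ.- n) ℤ.+ (j ℤ.- n))
  lemma = ℤ-RingSolver.solve-∀

T-sucˡ : ∀ i j m n → i ℕ.+ j ≡ m ℕ.+ n → i ℕ.+ T (ℤ.- (suc j ⊖ n)) ≡ m ℕ.+ T (ℤ.- (j ⊖ n))
-- The hypothesis enters by adding m + n on the left and the equal i + j on the right; what remains
-- is a polynomial identity in free variables.
T-sucˡ i j m n eq = ℕ.+-cancelˡ-≡ (m ℕ.+ n) _ _ (half-unique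
  ((half-2* m ⊞ half-2* n) ⊞ (half-2* i ⊞ half-T-neg-⊖ (suc j) n))
  (≡.subst (λ x → Half x (+ 2 ℤ.* + i ℤ.+ + 2 ℤ.* + j)) eq (half-2* i ⊞ half-2* j)
    ⊞ (half-2* m ⊞ half-T-neg-⊖ j n))
  (lemma (+ i) (+ j) (+ m) (+ n)))
  where
  lemma : ∀ i j m n →
    + 2 ℤ.* m ℤ.+ + 2 ℤ.* n ℤ.+ (+ 2 ℤ.* i ℤ.+ ((n ℤ.- (+ 1 ℤ.+ j)) ℤ.* (n ℤ.- (+ 1 ℤ.+ j)) ℤ.+ (n ℤ.- (+ 1 ℤ.+ j))))
    ≡ + 2 ℤ.* i ℤ.+ + 2 ℤ.* j ℤ.+ (+ 2 ℤ.* m ℤ.+ ((n ℤ.- j) ℤ.* (n ℤ.- j) ℤ.+ (n ℤ.- j)))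
  lemma = ℤ-RingSolver.solve-∀

T-sucʳ : ∀ i j m n → i ℕ.+ j ≡ m ℕ.+ n → i ℕ.+ T (suc j ⊖ n) ≡ suc m ℕ.+ T (j ⊖ n)
T-sucʳ i j m n eq = ℕ.+-cancelˡ-≡ (m ℕ.+ n) _ _ (half-unique
  ((half-2* m ⊞ half-2* n) ⊞ (half-2* i ⊞ half-T-⊖ (suc j) n))
  (≡.subst (λ x → Half x (+ 2 ℤ.* + i ℤ.+ + 2 ℤ.* + j)) eq (half-2* i ⊞ half-2* j)
    ⊞ (half-2* (suc m) ⊞ half-T-⊖ j n))
  (lemma (+ i) (+ j) (+ m) (+ n)))
  where
  lemma : ∀ i j m n →
    + 2 ℤ.* m ℤ.+ + 2 ℤ.* n ℤ.+ (+ 2 ℤ.* i ℤ.+ (((+ 1 ℤ.+ j) ℤ.- n) ℤ.* ((+ 1 ℤ.+ j) ℤ.- n) ℤ.+ ((+ 1 ℤ.+ j) ℤ.- n)))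
    ≡ + 2 ℤ.* i ℤ.+ + 2 ℤ.* j ℤ.+ (+ 2 ℤ.* (+ 1 ℤ.+ m) ℤ.+ ((j ℤ.- n) ℤ.* (j ℤ.- n) ℤ.+ (j ℤ.- n)))
  lemma = ℤ-RingSolver.solve-∀

-- Residues modulo 48, in decreasing order

S₁-residues T₁-residues S₂-residues T₂-residues : List ℕ
S₁-residues = 47 ∷ 44 ∷ 43 ∷ 42 ∷ 41 ∷ 39 ∷ 33 ∷ 31 ∷ 29 ∷ 28 ∷ 26 ∷ 25 ∷ 23 ∷ 22 ∷ 20 ∷ 19 ∷ 17 ∷ 15 ∷ 9 ∷ 7 ∷ 6 ∷ 5 ∷ 4 ∷ 1 ∷ []
T₁-residues = 47 ∷ 45 ∷ 44 ∷ 43 ∷ 37 ∷ 35 ∷ 34 ∷ 30 ∷ 29 ∷ 28 ∷ 27 ∷ 25 ∷ 23 ∷ 21 ∷ 20 ∷ 19 ∷ 18 ∷ 14 ∷ 13 ∷ 11 ∷ 5 ∷ 4 ∷ 3 ∷ 1 ∷ []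
S₂-residues = 46 ∷ 45 ∷ 44 ∷ 43 ∷ 41 ∷ 37 ∷ 35 ∷ 31 ∷ 30 ∷ 29 ∷ 28 ∷ 27 ∷ 21 ∷ 20 ∷ 19 ∷ 18 ∷ 17 ∷ 13 ∷ 11 ∷ 7 ∷ 5 ∷ 4 ∷ 3 ∷ 2 ∷ []
T₂-residues = 47 ∷ 44 ∷ 42 ∷ 41 ∷ 39 ∷ 38 ∷ 37 ∷ 35 ∷ 33 ∷ 31 ∷ 28 ∷ 25 ∷ 23 ∷ 20 ∷ 17 ∷ 15 ∷ 13 ∷ 11 ∷ 10 ∷ 9 ∷ 7 ∷ 6 ∷ 4 ∷ 1 ∷ []

module Theta {c ℓ} (R : CommutativeSemiring c ℓ) where

  open CommutativeSemiring R hiding (zero)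
  open import Algebra.Properties.CommutativeSemiring.Exp R
  open import Algebra.Solver.Ring.NaturalCoefficients.Default R
  import Algebra.Solver.CommutativeMonoid *-commutativeMonoid as Monomial
  open Monomial using (_⊕_; _⊜_; id)
  open import Relation.Binary.Reasoning.Setoid setoid

  -- Sums over antidiagonals

  diag : ℕ → ℕ → (ℕ → ℕ → Carrier) → Carrier
  diag zero    j f = f 0 j
  diag (suc i) j f = f (suc i) j + diag i (suc j) f

  diag-cong : ∀ i j {f g} → (∀ a b → a ℕ.+ b ≡ i ℕ.+ j → f a b ≈ g a b) → diag i j f ≈ diag i j g
  diag-cong zero    j f≈g = f≈g 0 j ≡.refl
  diag-cong (suc i) j f≈g =
    +-cong (f≈g (suc i) j ≡.refl) (diag-cong i (suc j) λ a b eq → f≈g a b (≡.trans eq (ℕ.+-suc i j)))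

  diag-*ˡ : ∀ i j x f → diag i j (λ a b → x * f a b) ≈ x * diag i j f
  diag-*ˡ zero    j x f = refl
  diag-*ˡ (suc i) j x f = trans (+-congˡ (diag-*ˡ i (suc j) x f)) (sym (distribˡ x _ _))

  diag-last : ∀ i j (h : ℕ → Carrier) → diag (suc i) j (λ _ → h) ≈ diag i j (λ _ → h) + h (suc i ℕ.+ j)
  diag-last zero    j h = refl
  diag-last (suc i) j h = begin
    h j + diag (suc i) (suc j) (λ _ → h)                      ≈⟨ +-congˡ (diag-last i (suc j) h) ⟩
    h j + (diag i (suc j) (λ _ → h) + h (suc i ℕ.+ suc j))    ≈⟨ +-assoc _ _ _ ⟨
    h j + diag i (suc j) (λ _ → h) + h (suc i ℕ.+ suc j)      ≈⟨ +-congˡ (reflexive (≡.cong h (ℕ.+-suc (suc i) j))) ⟩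
    h j + diag i (suc j) (λ _ → h) + h (suc (suc i) ℕ.+ j)    ∎

  diag-shift : ∀ i j (h : ℕ → Carrier) → diag i (suc j) (λ _ → h) ≈ diag i j (λ _ n → h (suc n))
  diag-shift zero    j h = refl
  diag-shift (suc i) j h = +-congˡ (diag-shift i (suc j) h)

  -- Gaussian binomial coefficients

  module _ (Q : Carrier) where

    -- The Gaussian binomial coefficient [i + j choose j] in base Q.
    gauss : ℕ → ℕ → Carrier
    gauss zero    j       = 1#
    gauss (suc i) zero    = 1#
    gauss (suc i) (suc j) = gauss (suc i) j + Q ^ suc j * gauss i (suc j)

    -- The mirror image of the Pascal rule that defines `gauss`. Both are needed: the two kinds of
    -- factors in the triple product use one rule each, and stability lowers i with one and j with
    -- the other.
    gauss-pascal : ∀ i j → gauss (suc i) (suc j) ≈ Q ^ suc i * gauss (suc i) j + gauss i (suc j)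
    gauss-pascal zero zero =
      solve 1 (λ q → con 1 :+ q :* con 1 :* con 1 := q :* con 1 :* con 1 :+ con 1) refl Q
    gauss-pascal zero (suc j) = begin
      gauss 1 (suc j) + Q ^ suc (suc j) * 1#
        ≈⟨ +-congʳ (gauss-pascal zero j) ⟩
      Q * 1# * gauss 1 j + 1# + Q ^ suc (suc j) * 1#
        ≈⟨ solve 3 (λ q g p → q :* con 1 :* g :+ con 1 :+ q :* p :* con 1
             := q :* con 1 :* (g :+ p :* con 1) :+ con 1) refl Q (gauss 1 j) (Q ^ suc j) ⟩
      Q * 1# * gauss 1 (suc j) + 1#
        ∎
    gauss-pascal (suc i) zero = begin
      1# + Q * 1# * gauss (suc i) 1
        ≈⟨ +-congˡ (*-congˡ (gauss-pascal i zero)) ⟩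
      1# + Q * 1# * (Q ^ suc i * 1# + gauss i 1)
        ≈⟨ solve 3 (λ q p g → con 1 :+ q :* con 1 :* (p :* con 1 :+ g)
             := q :* p :* con 1 :+ (con 1 :+ q :* con 1 :* g)) refl Q (Q ^ suc i) (gauss i 1) ⟩
      Q ^ suc (suc i) * 1# + gauss (suc i) 1
        ∎
    gauss-pascal (suc i) (suc j) = begin
      gauss (suc (suc i)) (suc j) + Q * Q ^ suc j * gauss (suc i) (suc (suc j))
        ≈⟨ +-cong (gauss-pascal (suc i) j) (*-congˡ (gauss-pascal i (suc j))) ⟩
      Q * Q ^ suc i * gauss (suc (suc i)) j + gauss (suc i) (suc j)
        + Q * Q ^ suc j * (Q ^ suc i * gauss (suc i) (suc j) + gauss i (suc (suc j)))
        ≈⟨ solve 6 (λ q p r x y z → q :* r :* x :+ y :+ q :* p :* (r :* y :+ z)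
             := q :* r :* (x :+ p :* y) :+ (y :+ q :* p :* z)) refl
             Q (Q ^ suc j) (Q ^ suc i) (gauss (suc (suc i)) j) (gauss (suc i) (suc j)) (gauss i (suc (suc j))) ⟩
      Q * Q ^ suc i * gauss (suc (suc i)) (suc j) + gauss (suc i) (suc (suc j))
        ∎

    module Step (α β : ℕ → Carrier) (α₀ : α 0 ≈ 1#) (β₀ : β 0 ≈ 1#)
                (pascal : ∀ i j → gauss (suc i) (suc j) ≈ α (suc i) * gauss (suc i) j + β (suc j) * gauss i (suc j))
                (t : ℕ → ℕ → Carrier) where

      private
        f g : ℕ → ℕ → Carrier
        f i j = gauss i j * t i j
        g i j = gauss i j * (α i * t i (suc j) + β j * t (suc i) j)

      -- The partial sum starts in the middle of the antidiagonal, so its first term also carries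
      -- the share of `gauss (suc i) j`, which the preceding term completes to a value of `g`.
      step-suc : ∀ i j → diag (suc i) (suc j) f
                       ≈ α (suc i) * gauss (suc i) j * t (suc i) (suc j) + diag i (suc j) g
      step-suc zero j = begin
        gauss 1 (suc j) * t 1 (suc j) + 1# * t 0 (suc (suc j))
          ≈⟨ +-cong (*-congʳ (pascal 0 j)) (*-congʳ (sym α₀)) ⟩
        (α 1 * gauss 1 j + β (suc j) * 1#) * t 1 (suc j) + α 0 * t 0 (suc (suc j))
          ≈⟨ solve 5 (λ a b u v w → (a :+ b :* con 1) :* u :+ v :* w
               := a :* u :+ con 1 :* (v :* w :+ b :* u)) refl
               (α 1 * gauss 1 j) (β (suc j)) (t 1 (suc j)) (α 0) (t 0 (suc (suc j))) ⟩
        α 1 * gauss 1 j * t 1 (suc j) + g 0 (suc j)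
          ∎
      step-suc (suc i) j = begin
        gauss (suc (suc i)) (suc j) * t (suc (suc i)) (suc j) + diag (suc i) (suc (suc j)) f
          ≈⟨ +-cong (*-congʳ (pascal (suc i) j)) (step-suc i (suc j)) ⟩
        (α (suc (suc i)) * gauss (suc (suc i)) j + β (suc j) * gauss (suc i) (suc j)) * t (suc (suc i)) (suc j)
          + (α (suc i) * gauss (suc i) (suc j) * t (suc i) (suc (suc j)) + diag i (suc (suc j)) g)
          ≈⟨ solve 7 (λ x b y u a v d → (x :+ b :* y) :* u :+ (a :* y :* v :+ d)
               := x :* u :+ (y :* (a :* v :+ b :* u) :+ d)) refl
               (α (suc (suc i)) * gauss (suc (suc i)) j) (β (suc j)) (gauss (suc i) (suc j))
               (t (suc (suc i)) (suc j)) (α (suc i)) (t (suc i) (suc (suc j))) (diag i (suc (suc j)) g) ⟩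
        α (suc (suc i)) * gauss (suc (suc i)) j * t (suc (suc i)) (suc j)
          + (g (suc i) (suc j) + diag i (suc (suc j)) g)
          ∎

      -- Regrouping by the smaller coefficients: `gauss i j` contributes to (i , j + 1) with weight
      -- `α i` and to (i + 1 , j) with weight `β j`. On the border, where `gauss` is 1, the rule
      -- persists because `α 0` and `β 0` are 1.
      step : ∀ n → diag (suc n) 0 f ≈ diag n 0 g
      step zero = begin
        1# * t 1 0 + 1# * t 0 1         ≈⟨ +-cong (*-congʳ (sym β₀)) (*-congʳ (sym α₀)) ⟩
        β 0 * t 1 0 + α 0 * t 0 1       ≈⟨ solve 2 (λ x y → x :+ y := con 1 :* (y :+ x)) refl _ _ ⟩
        1# * (α 0 * t 0 1 + β 0 * t 1 0) ∎
      step (suc n) = begin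
        1# * t (suc (suc n)) 0 + diag (suc n) 1 f
          ≈⟨ +-cong (*-congʳ (sym β₀)) (step-suc n 0) ⟩
        β 0 * t (suc (suc n)) 0 + (α (suc n) * gauss (suc n) 0 * t (suc n) 1 + diag n 1 g)
          ≈⟨ solve 4 (λ x a y d → x :+ (a :* con 1 :* y :+ d) := con 1 :* (a :* y :+ x) :+ d) refl
               (β 0 * t (suc (suc n)) 0) (α (suc n)) (t (suc n) 1) (diag n 1 g) ⟩
        g (suc n) 0 + diag n 1 g
          ∎

    step₁ : ∀ t n → diag (suc n) 0 (λ i j → gauss i j * t i j)
                  ≈ diag n 0 (λ i j → gauss i j * (1# * t i (suc j) + Q ^ j * t (suc i) j))
    step₁ = Step.step (λ _ → 1#) (Q ^_) refl refl (λ i j → +-congʳ (sym (*-identityˡ _)))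

    step₂ : ∀ t n → diag (suc n) 0 (λ i j → gauss i j * t i j)
                  ≈ diag n 0 (λ i j → gauss i j * (Q ^ i * t i (suc j) + 1# * t (suc i) j))
    step₂ = Step.step (Q ^_) (λ _ → 1#) refl refl
              (λ i j → trans (gauss-pascal i j) (+-congˡ (sym (*-identityˡ _))))

    module _ (N : ℕ) (Q^≈0 : ∀ n → suc N ℕ.≤ n → Q ^ n ≈ 0#) where

      -- Beyond N, each Pascal rule loses the summand weighted by a vanishing power of Q, so one
      -- rule lowers i and the other lowers j without changing the value.
      gauss-stable-+ : ∀ x y → gauss (suc (x ℕ.+ N)) (suc (y ℕ.+ N)) ≈ gauss (suc N) (suc N)
      gauss-stable-+ zero    zero    = refl
      gauss-stable-+ (suc x) zero    = begin
        gauss (suc (suc x ℕ.+ N)) (suc N)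
          ≈⟨ gauss-pascal (suc x ℕ.+ N) N ⟩
        Q ^ suc (suc x ℕ.+ N) * gauss (suc (suc x ℕ.+ N)) N + gauss (suc x ℕ.+ N) (suc N)
          ≈⟨ +-congʳ (trans (*-congʳ (Q^≈0 _ (s≤s (ℕ.m≤n+m N (suc x))))) (zeroˡ _)) ⟩
        0# + gauss (suc x ℕ.+ N) (suc N)
          ≈⟨ +-identityˡ _ ⟩
        gauss (suc (x ℕ.+ N)) (suc N)
          ≈⟨ gauss-stable-+ x zero ⟩
        gauss (suc N) (suc N)
          ∎
      gauss-stable-+ x       (suc y) = begin
        gauss (suc (x ℕ.+ N)) (suc y ℕ.+ N) + Q ^ suc (suc y ℕ.+ N) * gauss (x ℕ.+ N) (suc (suc y ℕ.+ N))
          ≈⟨ +-congˡ (trans (*-congʳ (Q^≈0 _ (s≤s (ℕ.m≤n+m N (suc y))))) (zeroˡ _)) ⟩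
        gauss (suc (x ℕ.+ N)) (suc y ℕ.+ N) + 0#
          ≈⟨ +-identityʳ _ ⟩
        gauss (suc (x ℕ.+ N)) (suc (y ℕ.+ N))
          ≈⟨ gauss-stable-+ x y ⟩
        gauss (suc N) (suc N)
          ∎

      gauss-stable : ∀ {i j} → suc N ℕ.≤ i → suc N ℕ.≤ j → gauss i j ≈ gauss (suc N) (suc N)
      gauss-stable N<i N<j with ℕ.m≤n⇒∃[o]m+o≡n N<i | ℕ.m≤n⇒∃[o]m+o≡n N<j
      ... | x , ≡.refl | y , ≡.refl rewrite ℕ.+-comm N x | ℕ.+-comm N y = gauss-stable-+ x y

  gauss-cong : ∀ {Q Q′} → Q ≈ Q′ → ∀ i j → gauss Q i j ≈ gauss Q′ i j
  gauss-cong Q≈Q′ zero    j       = refl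
  gauss-cong Q≈Q′ (suc i) zero    = refl
  gauss-cong Q≈Q′ (suc i) (suc j) =
    +-cong (gauss-cong Q≈Q′ (suc i) j) (*-cong (^-congˡ (suc j) Q≈Q′) (gauss-cong Q≈Q′ i (suc j)))

  -- Finite products and sums over symmetric ranges of integers

  ∏ : ℕ → (ℕ → Carrier) → Carrier
  ∏ zero    f = 1#
  ∏ (suc n) f = ∏ n f * f n

  ∏-cong : ∀ n {f g} → (∀ i → f i ≈ g i) → ∏ n f ≈ ∏ n g
  ∏-cong zero    f≈g = refl
  ∏-cong (suc n) f≈g = *-cong (∏-cong n f≈g) (f≈g n)

  ∏-* : ∀ n f g → ∏ n (λ i → f i * g i) ≈ ∏ n f * ∏ n g
  ∏-* zero    f g = sym (*-identityˡ 1#)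
  ∏-* (suc n) f g = trans (*-congʳ (∏-* n f g))
    (solve 4 (λ x y z w → x :* y :* (z :* w) := x :* z :* (y :* w)) refl (∏ n f) (∏ n g) (f n) (g n))

  ∏-double : ∀ n f → ∏ (n ℕ.+ n) f ≈ ∏ n (λ i → f (i ℕ.+ i)) * ∏ n (λ i → f (suc (i ℕ.+ i)))
  ∏-double zero    f = sym (*-identityˡ 1#)
  ∏-double (suc n) f rewrite ℕ.+-suc n n = trans (*-congʳ (*-congʳ (∏-double n f)))
    (solve 4 (λ x y z w → x :* y :* z :* w := x :* z :* (y :* w)) refl _ _ (f (n ℕ.+ n)) (f (suc (n ℕ.+ n))))

  ∏-extend : ∀ {m f} n → (∀ i → m ℕ.≤ i → f i ≈ 1#) → m ℕ.≤ n → ∏ n f ≈ ∏ m f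
  ∏-extend n f≈1 m≤n with ℕ.m≤n⇒m<n∨m≡n m≤n
  ... | inj₂ ≡.refl = refl
  ∏-extend (suc n) f≈1 m≤n | inj₁ (s≤s m≤n′) =
    trans (*-cong (∏-extend n f≈1 m≤n′) (f≈1 n m≤n′)) (*-identityʳ _)

  ΣZ : ℕ → (ℤ → Carrier) → Carrier
  ΣZ zero    f = f (+ 0)
  ΣZ (suc n) f = f -[1+ n ] + ΣZ n f + f (+ suc n)

  VanishesFrom : ℕ → (ℤ → Carrier) → Set ℓ
  VanishesFrom N f = ∀ k → N ℕ.≤ ∣ k ∣ → f k ≈ 0#

  diag-ΣZ : ∀ n f → diag (n ℕ.+ n) 0 (λ _ j → f (j ⊖ n)) ≈ ΣZ n f
  diag-ΣZ zero    f = refl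
  diag-ΣZ (suc n) f rewrite ℕ.+-suc n n = begin
    f -[1+ n ] + diag (suc (n ℕ.+ n)) 1 (λ _ → h)
      ≈⟨ +-congˡ (diag-shift (suc (n ℕ.+ n)) 0 h) ⟩
    f -[1+ n ] + diag (suc (n ℕ.+ n)) 0 (λ _ j → h (suc j))
      ≈⟨ +-congˡ (diag-last (n ℕ.+ n) 0 (λ j → h (suc j))) ⟩
    f -[1+ n ] + (diag (n ℕ.+ n) 0 (λ _ j → h (suc j)) + h (suc (suc (n ℕ.+ n ℕ.+ 0))))
      ≈⟨ +-assoc _ _ _ ⟨
    f -[1+ n ] + diag (n ℕ.+ n) 0 (λ _ j → h (suc j)) + h (suc (suc (n ℕ.+ n ℕ.+ 0)))
      ≈⟨ +-cong (+-congˡ (trans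
           (diag-cong (n ℕ.+ n) 0 (λ _ j _ → reflexive (≡.cong f (ℤ.[1+m]⊖[1+n]≡m⊖n j n))))
           (diag-ΣZ n f)))
         (reflexive (≡.cong f last)) ⟩
    f -[1+ n ] + ΣZ n f + f (+ suc n)
      ∎
    where
    h : ℕ → Carrier
    h j = f (j ⊖ suc n)
    last : suc (suc (n ℕ.+ n ℕ.+ 0)) ⊖ suc n ≡ + suc n
    last rewrite ℕ.+-identityʳ (n ℕ.+ n) | ℤ.[1+m]⊖[1+n]≡m⊖n (suc n ℕ.+ n) n =
      ≡.trans (ℤ.⊖-≥ (ℕ.m≤n+m n (suc n))) (≡.cong +_ (ℕ.m+n∸n≡m (suc n) n))

  -- The summand of Ramanujan's theta function f(u, v) = ∑ u^(k(k-1)/2) v^(k(k+1)/2). This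
  -- two-variable form of the triple product needs no inverses, which a nilpotent q could not
  -- supply.
  term : Carrier → Carrier → ℤ → Carrier
  term u v k = u ^ T (ℤ.- k) * v ^ T k

  -- The Jacobi triple product

  module _ (u v : Carrier) where

    private
      Q = u * v

    *-term : ∀ n a b → Q ^ n * (u ^ a * v ^ b) ≈ u ^ (n ℕ.+ a) * v ^ (n ℕ.+ b)
    *-term n a b = begin
      Q ^ n * (u ^ a * v ^ b)              ≈⟨ *-congʳ (^-distrib-* u v n) ⟩
      u ^ n * v ^ n * (u ^ a * v ^ b)      ≈⟨ solve 4 (λ x y z w → x :* y :* (z :* w) := x :* z :* (y :* w)) refl
                                                (u ^ n) (v ^ n) (u ^ a) (v ^ b) ⟩
      u ^ n * u ^ a * (v ^ n * v ^ b)      ≈⟨ *-cong (^-homo-* u n a) (^-homo-* v n b) ⟨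
      u ^ (n ℕ.+ a) * v ^ (n ℕ.+ b)        ∎

    term-pred : ∀ j n → Q ^ j * term u v (j ⊖ suc n) ≈ u * Q ^ n * term u v (j ⊖ n)
    term-pred j n = begin
      Q ^ j * term u v (j ⊖ suc n)
        ≈⟨ *-term j _ _ ⟩
      u ^ (j ℕ.+ T (ℤ.- (j ⊖ suc n))) * v ^ (j ℕ.+ T (j ⊖ suc n))
        ≈⟨ *-cong (^-congʳ u (T-predˡ j n)) (^-congʳ v (T-predʳ j n)) ⟩
      u * u ^ (n ℕ.+ T (ℤ.- (j ⊖ n))) * v ^ (n ℕ.+ T (j ⊖ n))
        ≈⟨ *-assoc _ _ _ ⟩
      u * (u ^ (n ℕ.+ T (ℤ.- (j ⊖ n))) * v ^ (n ℕ.+ T (j ⊖ n)))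
        ≈⟨ *-congˡ (*-term n _ _) ⟨
      u * (Q ^ n * term u v (j ⊖ n))
        ≈⟨ *-assoc _ _ _ ⟨
      u * Q ^ n * term u v (j ⊖ n)
        ∎

    term-suc : ∀ i j m n → i ℕ.+ j ≡ m ℕ.+ n → Q ^ i * term u v (suc j ⊖ n) ≈ v * Q ^ m * term u v (j ⊖ n)
    term-suc i j m n eq = begin
      Q ^ i * term u v (suc j ⊖ n)
        ≈⟨ *-term i _ _ ⟩
      u ^ (i ℕ.+ T (ℤ.- (suc j ⊖ n))) * v ^ (i ℕ.+ T (suc j ⊖ n))
        ≈⟨ *-cong (^-congʳ u (T-sucˡ i j m n eq)) (^-congʳ v (T-sucʳ i j m n eq)) ⟩
      u ^ (m ℕ.+ T (ℤ.- (j ⊖ n))) * (v * v ^ (m ℕ.+ T (j ⊖ n)))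
        ≈⟨ solve 3 (λ x y z → x :* (y :* z) := y :* (x :* z)) refl _ v _ ⟩
      v * (u ^ (m ℕ.+ T (ℤ.- (j ⊖ n))) * v ^ (m ℕ.+ T (j ⊖ n)))
        ≈⟨ *-congˡ (*-term m _ _) ⟨
      v * (Q ^ m * term u v (j ⊖ n))
        ≈⟨ *-assoc _ _ _ ⟨
      v * Q ^ m * term u v (j ⊖ n)
        ∎

    -- Rothe's q-binomial theorem: on i + j = n the theta term has index -i and equals u^i
    -- Q^(i(i-1)/2).
    finite-jacobi₀ : ∀ n → ∏ n (λ i → 1# + u * Q ^ i) ≈ diag n 0 (λ i j → gauss Q i j * term u v (j ⊖ n))
    finite-jacobi₀ zero    = solve 0 (con 1 := con 1 :* (con 1 :* con 1)) refl
    finite-jacobi₀ (suc n) = begin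
      ∏ n (λ i → 1# + u * Q ^ i) * (1# + u * Q ^ n)
        ≈⟨ *-comm _ _ ⟩
      (1# + u * Q ^ n) * ∏ n (λ i → 1# + u * Q ^ i)
        ≈⟨ *-congˡ (finite-jacobi₀ n) ⟩
      (1# + u * Q ^ n) * diag n 0 (λ i j → gauss Q i j * term u v (j ⊖ n))
        ≈⟨ diag-*ˡ n 0 _ _ ⟨
      diag n 0 (λ i j → (1# + u * Q ^ n) * (gauss Q i j * term u v (j ⊖ n)))
        ≈⟨ diag-cong n 0 (λ i j _ → recurrence i j) ⟨
      diag n 0 (λ i j → gauss Q i j * (1# * term u v (suc j ⊖ suc n) + Q ^ j * term u v (j ⊖ suc n)))
        ≈⟨ step₁ Q (λ i j → term u v (j ⊖ suc n)) n ⟨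
      diag (suc n) 0 (λ i j → gauss Q i j * term u v (j ⊖ suc n))
        ∎
      where
      recurrence : ∀ i j → gauss Q i j * (1# * term u v (suc j ⊖ suc n) + Q ^ j * term u v (j ⊖ suc n))
                         ≈ (1# + u * Q ^ n) * (gauss Q i j * term u v (j ⊖ n))
      recurrence i j = begin
        gauss Q i j * (1# * term u v (suc j ⊖ suc n) + Q ^ j * term u v (j ⊖ suc n))
          ≈⟨ *-congˡ (+-cong (*-congˡ (reflexive (≡.cong (term u v) (ℤ.[1+m]⊖[1+n]≡m⊖n j n)))) (term-pred j n)) ⟩
        gauss Q i j * (1# * term u v (j ⊖ n) + u * Q ^ n * term u v (j ⊖ n))
          ≈⟨ solve 3 (λ g x w → g :* (con 1 :* w :+ x :* w) := (con 1 :+ x) :* (g :* w)) refl _ (u * Q ^ n) _ ⟩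
        (1# + u * Q ^ n) * (gauss Q i j * term u v (j ⊖ n))
          ∎

    -- The finite form of the triple product. With the centre n of the theta index fixed, each new
    -- factor in v lengthens the antidiagonal by one through the mirrored Pascal rule.
    finite-jacobi : ∀ m n → ∏ n (λ i → 1# + u * Q ^ i) * ∏ m (λ i → 1# + v * Q ^ i)
                          ≈ diag (m ℕ.+ n) 0 (λ i j → gauss Q i j * term u v (j ⊖ n))
    finite-jacobi zero    n = trans (*-identityʳ _) (finite-jacobi₀ n)
    finite-jacobi (suc m) n = begin
      ∏ n (λ i → 1# + u * Q ^ i) * (∏ m (λ i → 1# + v * Q ^ i) * (1# + v * Q ^ m))
        ≈⟨ solve 3 (λ x y z → x :* (y :* z) := z :* (x :* y)) refl _ _ _ ⟩
      (1# + v * Q ^ m) * (∏ n (λ i → 1# + u * Q ^ i) * ∏ m (λ i → 1# + v * Q ^ i))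
        ≈⟨ *-congˡ (finite-jacobi m n) ⟩
      (1# + v * Q ^ m) * diag (m ℕ.+ n) 0 (λ i j → gauss Q i j * term u v (j ⊖ n))
        ≈⟨ diag-*ˡ (m ℕ.+ n) 0 _ _ ⟨
      diag (m ℕ.+ n) 0 (λ i j → (1# + v * Q ^ m) * (gauss Q i j * term u v (j ⊖ n)))
        ≈⟨ diag-cong (m ℕ.+ n) 0 (λ i j eq → recurrence i j (≡.trans eq (ℕ.+-identityʳ _))) ⟨
      diag (m ℕ.+ n) 0 (λ i j → gauss Q i j * (Q ^ i * term u v (suc j ⊖ n) + 1# * term u v (j ⊖ n)))
        ≈⟨ step₂ Q (λ i j → term u v (j ⊖ n)) (m ℕ.+ n) ⟨
      diag (suc m ℕ.+ n) 0 (λ i j → gauss Q i j * term u v (j ⊖ n))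
        ∎
      where
      recurrence : ∀ i j → i ℕ.+ j ≡ m ℕ.+ n →
                   gauss Q i j * (Q ^ i * term u v (suc j ⊖ n) + 1# * term u v (j ⊖ n))
                   ≈ (1# + v * Q ^ m) * (gauss Q i j * term u v (j ⊖ n))
      recurrence i j eq = trans (*-congˡ (+-congʳ (term-suc i j m n eq)))
        (solve 3 (λ g x w → g :* (x :* w :+ con 1 :* w) := (con 1 :+ x) :* (g :* w)) refl _ (v * Q ^ m) _)

    module _ (N : ℕ) (u^≈0 : ∀ n → suc N ℕ.≤ n → u ^ n ≈ 0#) (v^≈0 : ∀ n → suc N ℕ.≤ n → v ^ n ≈ 0#) where

      term-vanishes : VanishesFrom (suc N) (term u v)
      term-vanishes (+ n) N<n =
        trans (*-congˡ (v^≈0 (tri n) (ℕ.≤-trans N<n (n≤tri[n] n)))) (zeroʳ _)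
      term-vanishes -[1+ n ] N<n =
        trans (*-congʳ (u^≈0 (tri (suc n)) (ℕ.≤-trans N<n (n≤tri[n] (suc n))))) (zeroˡ _)

      -- On i + j = 2L either both i and j exceed N, and the Gaussian coefficient has its stable
      -- value, or one of them is at most N, and then j - L has absolute value above N and the theta
      -- term vanishes. The choice L = 2(N + 1) makes these cases exhaustive.
      jacobi : let L = suc N ℕ.+ suc N in
        ∏ L (λ i → 1# + u * Q ^ i) * ∏ L (λ i → 1# + v * Q ^ i) ≈ gauss Q (suc N) (suc N) * ΣZ L (term u v)
      jacobi = begin
        ∏ L (λ i → 1# + u * Q ^ i) * ∏ L (λ i → 1# + v * Q ^ i)
          ≈⟨ finite-jacobi L L ⟩
        diag (L ℕ.+ L) 0 (λ i j → gauss Q i j * term u v (j ⊖ L))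
          ≈⟨ diag-cong (L ℕ.+ L) 0 (λ i j eq → stable i j (≡.trans eq (ℕ.+-identityʳ _))) ⟩
        diag (L ℕ.+ L) 0 (λ i j → gauss Q (suc N) (suc N) * term u v (j ⊖ L))
          ≈⟨ diag-*ˡ (L ℕ.+ L) 0 _ _ ⟩
        gauss Q (suc N) (suc N) * diag (L ℕ.+ L) 0 (λ i j → term u v (j ⊖ L))
          ≈⟨ *-congˡ (diag-ΣZ L (term u v)) ⟩
        gauss Q (suc N) (suc N) * ΣZ L (term u v)
          ∎
        where
        L = suc N ℕ.+ suc N
        Q^≈0 : ∀ n → suc N ℕ.≤ n → Q ^ n ≈ 0#
        Q^≈0 n N<n = trans (^-distrib-* u v n) (trans (*-congʳ (u^≈0 n N<n)) (zeroˡ _))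
        vanishing : ∀ i j → suc N ℕ.≤ ∣ j ⊖ L ∣ →
                    gauss Q i j * term u v (j ⊖ L) ≈ gauss Q (suc N) (suc N) * term u v (j ⊖ L)
        vanishing i j far = trans (trans (*-congˡ zero-term) (zeroʳ _)) (sym (trans (*-congˡ zero-term) (zeroʳ _)))
          where zero-term = term-vanishes (j ⊖ L) far
        stable : ∀ i j → i ℕ.+ j ≡ L ℕ.+ L →
                 gauss Q i j * term u v (j ⊖ L) ≈ gauss Q (suc N) (suc N) * term u v (j ⊖ L)
        stable i j eq with ℕ.≤-<-connex (suc N) i | ℕ.≤-<-connex (suc N) j
        ... | inj₁ N<i | inj₁ N<j = *-congʳ (gauss-stable Q N Q^≈0 N<i N<j)
        ... | inj₂ i≤N | _ = vanishing i j (ℕ.≤-trans (ℕ.m+n≤o⇒m≤o∸n (suc N) {L} bound) (ℕ.≤-reflexive (≡.sym (≡.cong ∣_∣ (ℤ.⊖-≥ {j} {L} (ℕ.m+n≤o⇒n≤o (suc N) bound))))))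
          where
          bound : suc N ℕ.+ L ℕ.≤ j
          bound = ℕ.+-cancelˡ-≤ i _ _ (≡.subst (i ℕ.+ (suc N ℕ.+ L) ℕ.≤_) (≡.sym eq)
            (≡.subst (ℕ._≤ L ℕ.+ L) (ℕ.+-assoc i (suc N) L) (ℕ.+-monoˡ-≤ L (ℕ.+-monoˡ-≤ (suc N) (ℕ.<⇒≤ i≤N)))))
        ... | inj₁ _ | inj₂ j≤N = vanishing i j (ℕ.≤-trans (ℕ.m+n≤o⇒m≤o∸n (suc N) (ℕ.+-monoʳ-≤ (suc N) (ℕ.<⇒≤ j≤N)))
            (ℕ.≤-reflexive (≡.sym (ℤ.∣⊖∣-≤ (ℕ.≤-trans (ℕ.<⇒≤ j≤N) (ℕ.m≤m+n (suc N) (suc N)))))))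

  -- Reindexing sums over the integers

  ΣZ-cong : ∀ n {f g} → (∀ k → ∣ k ∣ ℕ.≤ n → f k ≈ g k) → ΣZ n f ≈ ΣZ n g
  ΣZ-cong zero    f≈g = f≈g (+ 0) z≤n
  ΣZ-cong (suc n) f≈g = +-cong
    (+-cong (f≈g -[1+ n ] ℕ.≤-refl) (ΣZ-cong n λ k k≤n → f≈g k (ℕ.m≤n⇒m≤1+n k≤n)))
    (f≈g (+ suc n) ℕ.≤-refl)

  ΣZ-+ : ∀ n f g → ΣZ n (λ k → f k + g k) ≈ ΣZ n f + ΣZ n g
  ΣZ-+ zero    f g = refl
  ΣZ-+ (suc n) f g = trans (+-congʳ (+-congˡ (ΣZ-+ n f g)))
    (solve 6 (λ a a′ b b′ c c′ → (a :+ a′) :+ (b :+ b′) :+ (c :+ c′) := a :+ b :+ c :+ (a′ :+ b′ :+ c′)) refl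
      (f -[1+ n ]) (g -[1+ n ]) (ΣZ n f) (ΣZ n g) (f (+ suc n)) (g (+ suc n)))

  ΣZ-*ˡ : ∀ n x f → ΣZ n (λ k → x * f k) ≈ x * ΣZ n f
  ΣZ-*ˡ zero    x f = refl
  ΣZ-*ˡ (suc n) x f = trans (+-congʳ (+-congˡ (ΣZ-*ˡ n x f)))
    (solve 4 (λ x a b c → x :* a :+ x :* b :+ x :* c := x :* (a :+ b :+ c)) refl x (f -[1+ n ]) (ΣZ n f) (f (+ suc n)))

  ΣZ-*ʳ : ∀ n x f → ΣZ n (λ k → f k * x) ≈ ΣZ n f * x
  ΣZ-*ʳ n x f = trans (ΣZ-cong n λ k _ → *-comm (f k) x) (trans (ΣZ-*ˡ n x f) (*-comm x (ΣZ n f)))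

  ΣZ-0 : ∀ n {f} → (∀ k → f k ≈ 0#) → ΣZ n f ≈ 0#
  ΣZ-0 zero    f≈0 = f≈0 (+ 0)
  ΣZ-0 (suc n) f≈0 = trans (+-cong (+-cong (f≈0 -[1+ n ]) (ΣZ-0 n f≈0)) (f≈0 (+ suc n)))
    (trans (+-identityʳ _) (+-identityʳ _))

  ΣZ-swap : ∀ m n (f : ℤ → ℤ → Carrier) → ΣZ m (λ i → ΣZ n (f i)) ≈ ΣZ n (λ j → ΣZ m (λ i → f i j))
  ΣZ-swap zero    n f = refl
  ΣZ-swap (suc m) n f = begin
    ΣZ n (f -[1+ m ]) + ΣZ m (λ i → ΣZ n (f i)) + ΣZ n (f (+ suc m))
      ≈⟨ +-congʳ (+-congˡ (ΣZ-swap m n f)) ⟩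
    ΣZ n (f -[1+ m ]) + ΣZ n (λ j → ΣZ m (λ i → f i j)) + ΣZ n (f (+ suc m))
      ≈⟨ +-congʳ (ΣZ-+ n _ _) ⟨
    ΣZ n (λ j → f -[1+ m ] j + ΣZ m (λ i → f i j)) + ΣZ n (f (+ suc m))
      ≈⟨ ΣZ-+ n _ _ ⟨
    ΣZ n (λ j → ΣZ (suc m) (λ i → f i j))
      ∎

  ΣZ-separate : ∀ m n x α β → ΣZ m (λ i → ΣZ n (λ j → x * (α i * β j))) ≈ x * (ΣZ m α * ΣZ n β)
  ΣZ-separate m n x α β = begin
    ΣZ m (λ i → ΣZ n (λ j → x * (α i * β j)))
      ≈⟨ ΣZ-cong m (λ i _ → trans (ΣZ-*ˡ n x _) (*-congˡ (ΣZ-*ˡ n (α i) β))) ⟩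
    ΣZ m (λ i → x * (α i * ΣZ n β))
      ≈⟨ ΣZ-*ˡ m x _ ⟩
    x * ΣZ m (λ i → α i * ΣZ n β)
      ≈⟨ *-congˡ (ΣZ-*ʳ m (ΣZ n β) α) ⟩
    x * (ΣZ m α * ΣZ n β)
      ∎

  ΣZ-extend : ∀ {N f} n → VanishesFrom (suc N) f → N ℕ.≤ n → ΣZ n f ≈ ΣZ N f
  ΣZ-extend {N} {f} n vanish N≤n with ℕ.m≤n⇒m<n∨m≡n N≤n
  ... | inj₂ ≡.refl = refl
  ΣZ-extend {N} {f} (suc n) vanish N≤n | inj₁ (s≤s N≤n′) = begin
    f -[1+ n ] + ΣZ n f + f (+ suc n)
      ≈⟨ +-cong (+-cong (vanish -[1+ n ] (s≤s N≤n′)) (ΣZ-extend n vanish N≤n′)) (vanish (+ suc n) (s≤s N≤n′)) ⟩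
    0# + ΣZ N f + 0#
      ≈⟨ trans (+-identityʳ _) (+-identityˡ _) ⟩
    ΣZ N f
      ∎

  ΣZ-neg : ∀ n f → ΣZ n (λ k → f (ℤ.- k)) ≈ ΣZ n f
  ΣZ-neg zero    f = refl
  ΣZ-neg (suc n) f = trans (+-congʳ (+-congˡ (ΣZ-neg n f)))
    (solve 3 (λ a b c → a :+ b :+ c := c :+ b :+ a) refl (f (+ suc n)) (ΣZ n f) (f -[1+ n ]))

  -- Moving the window by one drops its lower end and gains a new upper end; each stands on the side
  -- where it is missing, as a semiring has no subtraction.
  ΣZ-suc : ∀ n f → ΣZ n (λ k → f (+ 1 ℤ.+ k)) + f (ℤ.- (+ n)) ≈ ΣZ n f + f (+ suc n)
  ΣZ-suc zero    f = +-comm _ _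
  ΣZ-suc (suc n) f = begin
    f (+ 1 ℤ.+ -[1+ n ]) + ΣZ n (λ k → f (+ 1 ℤ.+ k)) + f (+ suc (suc n)) + f -[1+ n ]
      ≈⟨ +-congʳ (+-congʳ (+-congʳ (reflexive (≡.cong f (≡.trans (ℤ.[1+m]⊖[1+n]≡m⊖n 0 n) (0⊖ n)))))) ⟩
    f (ℤ.- (+ n)) + ΣZ n (λ k → f (+ 1 ℤ.+ k)) + f (+ suc (suc n)) + f -[1+ n ]
      ≈⟨ solve 4 (λ a b c d → a :+ b :+ c :+ d := b :+ a :+ c :+ d) refl
           (f (ℤ.- (+ n))) (ΣZ n (λ k → f (+ 1 ℤ.+ k))) (f (+ suc (suc n))) (f -[1+ n ]) ⟩
    ΣZ n (λ k → f (+ 1 ℤ.+ k)) + f (ℤ.- (+ n)) + f (+ suc (suc n)) + f -[1+ n ]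
      ≈⟨ +-congʳ (+-congʳ (ΣZ-suc n f)) ⟩
    ΣZ n f + f (+ suc n) + f (+ suc (suc n)) + f -[1+ n ]
      ≈⟨ solve 4 (λ a b c d → a :+ b :+ c :+ d := d :+ a :+ b :+ c) refl
           (ΣZ n f) (f (+ suc n)) (f (+ suc (suc n))) (f -[1+ n ]) ⟩
    ΣZ (suc n) f + f (+ suc (suc n))
      ∎
    where
    0⊖ : ∀ n → 0 ⊖ n ≡ ℤ.- (+ n)
    0⊖ zero    = ≡.refl
    0⊖ (suc n) = ≡.refl

  ΣZ-shift-ℕ : ∀ {N f} m n → VanishesFrom (suc N) f → N ℕ.+ m ℕ.≤ n → ΣZ n (λ k → f (+ m ℤ.+ k)) ≈ ΣZ n f
  ΣZ-shift-ℕ {f = f} zero n vanish N+m≤n = ΣZ-cong n λ k _ → reflexive (≡.cong f (ℤ.+-identityˡ k))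
  ΣZ-shift-ℕ {N} {f} (suc m) n vanish N+m≤n = begin
    ΣZ n (λ k → f (+ suc m ℤ.+ k))
      ≈⟨ ΣZ-cong n (λ k _ → reflexive (≡.cong f (ℤ.+-assoc (+ 1) (+ m) k))) ⟩
    ΣZ n (λ k → f (+ 1 ℤ.+ (+ m ℤ.+ k)))
      ≈⟨ ΣZ-shift-ℕ {suc N} {λ k → f (+ 1 ℤ.+ k)} m n vanish-suc (ℕ.≤-trans (ℕ.≤-reflexive (≡.sym (ℕ.+-suc N m))) N+m≤n) ⟩
    ΣZ n (λ k → f (+ 1 ℤ.+ k))
      ≈⟨ +-identityʳ _ ⟨
    ΣZ n (λ k → f (+ 1 ℤ.+ k)) + 0#
      ≈⟨ +-congˡ (vanish (ℤ.- (+ n)) (ℕ.≤-trans N<n (ℕ.≤-reflexive (≡.sym (ℤ.∣-i∣≡∣i∣ (+ n)))))) ⟨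
    ΣZ n (λ k → f (+ 1 ℤ.+ k)) + f (ℤ.- (+ n))
      ≈⟨ ΣZ-suc n f ⟩
    ΣZ n f + f (+ suc n)
      ≈⟨ +-congˡ (vanish (+ suc n) (ℕ.m≤n⇒m≤1+n N<n)) ⟩
    ΣZ n f + 0#
      ≈⟨ +-identityʳ _ ⟩
    ΣZ n f
      ∎
    where
    N<n : suc N ℕ.≤ n
    N<n = ℕ.≤-trans (ℕ.≤-trans (s≤s (ℕ.m≤m+n N m)) (ℕ.≤-reflexive (≡.sym (ℕ.+-suc N m)))) N+m≤n
    vanish-suc : VanishesFrom (suc (suc N)) (λ k → f (+ 1 ℤ.+ k))
    vanish-suc (+ k)        N<k       = vanish (+ suc k) (ℕ.m≤n⇒m≤1+n (ℕ.<⇒≤ N<k))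
    vanish-suc -[1+ zero ]  (s≤s ())
    vanish-suc -[1+ suc k ] (s≤s N<k) = vanish -[1+ k ] N<k

  ΣZ-shift : ∀ {N f} c n → VanishesFrom (suc N) f → N ℕ.+ ∣ c ∣ ℕ.≤ n → ΣZ n (λ k → f (c ℤ.+ k)) ≈ ΣZ n f
  ΣZ-shift (+ m) n vanish N+c≤n = ΣZ-shift-ℕ m n vanish N+c≤n
  ΣZ-shift {N} {f} -[1+ m ] n vanish N+c≤n = begin
    ΣZ n (λ k → f (-[1+ m ] ℤ.+ k))
      ≈⟨ ΣZ-neg n (λ k → f (-[1+ m ] ℤ.+ k)) ⟨
    ΣZ n (λ k → f (-[1+ m ] ℤ.+ ℤ.- k))
      ≈⟨ ΣZ-cong n (λ k _ → reflexive (≡.cong f (ℤ.neg-distrib-+ (+ suc m) k))) ⟨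
    ΣZ n (λ k → f (ℤ.- (+ suc m ℤ.+ k)))
      ≈⟨ ΣZ-shift-ℕ {N} {λ k → f (ℤ.- k)} (suc m) n (λ k N<k → vanish (ℤ.- k) (≡.subst (suc N ℕ.≤_) (≡.sym (ℤ.∣-i∣≡∣i∣ k)) N<k)) N+c≤n ⟩
    ΣZ n (λ k → f (ℤ.- k))
      ≈⟨ ΣZ-neg n f ⟩
    ΣZ n f
      ∎

  -- The odd numbers 2i - 1 with i between -n and n start at -(2n + 1), one below the window of
  -- radius 2n; hence the extra term.
  ΣZ-parity : ∀ n f → ΣZ n (λ i → f (i ℤ.* + 2)) + ΣZ n (λ i → f (ℤ.- (+ 1) ℤ.+ i ℤ.* + 2))
                    ≈ ΣZ (n ℕ.* 2) f + f -[1+ n ℕ.* 2 ]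
  ΣZ-parity zero    f = refl
  ΣZ-parity (suc n) f = begin
    a + ΣZ n (λ i → f (i ℤ.* + 2)) + b + (a′ + ΣZ n (λ i → f (ℤ.- (+ 1) ℤ.+ i ℤ.* + 2)) + b′)
      ≈⟨ solve 6 (λ a x b a′ y b′ → a :+ x :+ b :+ (a′ :+ y :+ b′) := a :+ (x :+ y :+ b′) :+ b :+ a′) refl a _ b a′ _ b′ ⟩
    a + (ΣZ n (λ i → f (i ℤ.* + 2)) + ΣZ n (λ i → f (ℤ.- (+ 1) ℤ.+ i ℤ.* + 2)) + b′) + b + a′
      ≈⟨ +-congʳ (+-congʳ (+-congˡ (+-congʳ (ΣZ-parity n f)))) ⟩
    a + (ΣZ (n ℕ.* 2) f + f -[1+ n ℕ.* 2 ] + b′) + b + a′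
      ≈⟨ solve 6 (λ a x y b b′ a′ → a :+ (x :+ y :+ b′) :+ b :+ a′ := a :+ (y :+ x :+ b′) :+ b :+ a′) refl a _ _ b b′ a′ ⟩
    ΣZ (suc n ℕ.* 2) f + f -[1+ suc n ℕ.* 2 ]
      ∎
    where
    a  = f (-[1+ n ] ℤ.* + 2)
    b  = f (+ suc n ℤ.* + 2)
    a′ = f (ℤ.- (+ 1) ℤ.+ -[1+ n ] ℤ.* + 2)
    b′ = f (ℤ.- (+ 1) ℤ.+ + suc n ℤ.* + 2)

  module _ {N : ℕ} {α β : ℤ → Carrier} (α-vanish : VanishesFrom (suc N) α) (β-vanish : VanishesFrom (suc N) β) where

    private
      convolution : ℤ → Carrier
      convolution s = ΣZ N (λ k → α k * β (s ℤ.- k))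

      -- Substitutes k = i + j. The range of j has to grow to 2N, since i moves the support by up to
      -- N.
      recentre : ∀ c i → ∣ i ∣ ℕ.≤ N →
                 ΣZ N (λ k → α k * β ((c ℤ.+ i ℤ.* + 2) ℤ.- k)) ≈ ΣZ (N ℕ.+ N) (λ j → α (i ℤ.+ j) * β (c ℤ.+ (i ℤ.- j)))
      recentre c i i≤N = begin
        ΣZ N h
          ≈⟨ ΣZ-extend (N ℕ.+ N) h-vanish (ℕ.m≤m+n N N) ⟨
        ΣZ (N ℕ.+ N) h
          ≈⟨ ΣZ-shift i (N ℕ.+ N) h-vanish (ℕ.+-monoʳ-≤ N i≤N) ⟨
        ΣZ (N ℕ.+ N) (λ j → h (i ℤ.+ j))
          ≈⟨ ΣZ-cong (N ℕ.+ N) (λ j _ → *-congˡ (reflexive (≡.cong β (lemma c i j)))) ⟩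
        ΣZ (N ℕ.+ N) (λ j → α (i ℤ.+ j) * β (c ℤ.+ (i ℤ.- j)))
          ∎
        where
        h : ℤ → Carrier
        h k = α k * β ((c ℤ.+ i ℤ.* + 2) ℤ.- k)
        h-vanish : VanishesFrom (suc N) h
        h-vanish k N<k = trans (*-congʳ (α-vanish k N<k)) (zeroˡ _)
        lemma : ∀ c i j → (c ℤ.+ i ℤ.* + 2) ℤ.- (i ℤ.+ j) ≡ c ℤ.+ (i ℤ.- j)
        lemma = ℤ-RingSolver.solve-∀

    -- The double sum over (k , l) is collected by s = k + l, s is split into 2i and 2i - 1, and k
    -- is then recentred at i.
    ΣZ-*-ΣZ : ΣZ N α * ΣZ N β ≈ ΣZ N (λ i → ΣZ (N ℕ.+ N) (λ j → α (i ℤ.+ j) * β (i ℤ.- j)))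
                              + ΣZ N (λ i → ΣZ (N ℕ.+ N) (λ j → α (i ℤ.+ j) * β (ℤ.- (+ 1) ℤ.+ (i ℤ.- j))))
    ΣZ-*-ΣZ = begin
      ΣZ N α * ΣZ N β
        ≈⟨ ΣZ-*ʳ N (ΣZ N β) α ⟨
      ΣZ N (λ k → α k * ΣZ N β)
        ≈⟨ ΣZ-cong N (λ k k≤N → *-congˡ (shifted k k≤N)) ⟨
      ΣZ N (λ k → α k * ΣZ (N ℕ.* 2) (λ s → β (s ℤ.- k)))
        ≈⟨ ΣZ-cong N (λ k k≤N → ΣZ-*ˡ (N ℕ.* 2) (α k) _) ⟨
      ΣZ N (λ k → ΣZ (N ℕ.* 2) (λ s → α k * β (s ℤ.- k)))
        ≈⟨ ΣZ-swap N (N ℕ.* 2) _ ⟩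
      ΣZ (N ℕ.* 2) convolution
        -- The extra index s = -(2N + 1) demanded by `ΣZ-parity` costs nothing: for k within N, s -
        -- k lies outside the support of `β`.
        ≈⟨ trans (+-congˡ boundary) (+-identityʳ _) ⟨
      ΣZ (N ℕ.* 2) convolution + convolution -[1+ N ℕ.* 2 ]
        ≈⟨ ΣZ-parity N convolution ⟨
      ΣZ N (λ i → convolution (i ℤ.* + 2)) + ΣZ N (λ i → convolution (ℤ.- (+ 1) ℤ.+ i ℤ.* + 2))
        ≈⟨ +-cong
             (ΣZ-cong N λ i i≤N → trans
               (ΣZ-cong N λ k _ → *-congˡ (reflexive (≡.cong (λ s → β (s ℤ.- k)) (≡.sym (ℤ.+-identityˡ (i ℤ.* + 2))))))
               (trans (recentre (+ 0) i i≤N)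
               (ΣZ-cong (N ℕ.+ N) λ j _ → *-congˡ (reflexive (≡.cong β (ℤ.+-identityˡ (i ℤ.- j)))))))
             (ΣZ-cong N λ i i≤N → recentre (ℤ.- (+ 1)) i i≤N) ⟩
      ΣZ N (λ i → ΣZ (N ℕ.+ N) (λ j → α (i ℤ.+ j) * β (i ℤ.- j)))
        + ΣZ N (λ i → ΣZ (N ℕ.+ N) (λ j → α (i ℤ.+ j) * β (ℤ.- (+ 1) ℤ.+ (i ℤ.- j))))
        ∎
      where
      N+N≤N*2 : N ℕ.+ N ℕ.≤ N ℕ.* 2
      N+N≤N*2 = ℕ.≤-reflexive (≡.sym (≡.trans (ℕ.*-comm N 2) (≡.cong (N ℕ.+_) (ℕ.+-identityʳ N))))
      shifted : ∀ k → ∣ k ∣ ℕ.≤ N → ΣZ (N ℕ.* 2) (λ s → β (s ℤ.- k)) ≈ ΣZ N β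
      shifted k k≤N = begin
        ΣZ (N ℕ.* 2) (λ s → β (s ℤ.- k))
          ≈⟨ ΣZ-cong (N ℕ.* 2) (λ s _ → reflexive (≡.cong β (ℤ.+-comm s (ℤ.- k)))) ⟩
        ΣZ (N ℕ.* 2) (λ s → β (ℤ.- k ℤ.+ s))
          ≈⟨ ΣZ-shift (ℤ.- k) (N ℕ.* 2) β-vanish
               (ℕ.≤-trans (ℕ.+-monoʳ-≤ N (≡.subst (ℕ._≤ N) (≡.sym (ℤ.∣-i∣≡∣i∣ k)) k≤N)) N+N≤N*2) ⟩
        ΣZ (N ℕ.* 2) β
          ≈⟨ ΣZ-extend (N ℕ.* 2) β-vanish (ℕ.≤-trans (ℕ.m≤m+n N N) N+N≤N*2) ⟩
        ΣZ N β
          ∎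
      far : ∀ k → ∣ k ∣ ℕ.≤ N → suc N ℕ.≤ ∣ -[1+ N ℕ.* 2 ] ℤ.- k ∣
      far k k≤N = ℕ.+-cancelʳ-≤ N _ _ (ℕ.≤-trans (s≤s N+N≤N*2)
        (ℕ.≤-trans (ℕ.≤-reflexive (≡.cong ∣_∣ (lemma -[1+ N ℕ.* 2 ] k)))
        (ℕ.≤-trans (ℤ.∣i+j∣≤∣i∣+∣j∣ (-[1+ N ℕ.* 2 ] ℤ.- k) k) (ℕ.+-monoʳ-≤ _ k≤N))))
        where
        lemma : ∀ x k → x ≡ x ℤ.- k ℤ.+ k
        lemma = ℤ-RingSolver.solve-∀
      boundary : convolution -[1+ N ℕ.* 2 ] ≈ 0#
      boundary = trans
        (ΣZ-cong N (λ k k≤N → trans (*-congˡ (β-vanish (-[1+ N ℕ.* 2 ] ℤ.- k) (far k k≤N))) (zeroʳ _)))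
        (ΣZ-0 N λ _ → refl)

  1^n≈1 : ∀ n → 1# ^ n ≈ 1#
  1^n≈1 zero    = refl
  1^n≈1 (suc n) = trans (*-identityˡ _) (1^n≈1 n)

  x^[n+n]≈1 : ∀ {x} → x * x ≈ 1# → ∀ n → x ^ (n ℕ.+ n) ≈ 1#
  x^[n+n]≈1 {x} x²≈1 n = begin
    x ^ (n ℕ.+ n)    ≈⟨ ^-homo-* x n n ⟩
    x ^ n * x ^ n    ≈⟨ ^-distrib-* x x n ⟨
    (x * x) ^ n      ≈⟨ ^-congˡ n x²≈1 ⟩
    1# ^ n           ≈⟨ 1^n≈1 n ⟩
    1#               ∎

  -- Theta series in a nilpotent q

  module Truncated (q : Carrier) (N : ℕ) (q^≈0 : ∀ n → suc N ℕ.≤ n → q ^ n ≈ 0#) where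

    thetaTerm : Carrier → ℕ → ℕ → ℤ → Carrier
    thetaTerm s a b = term (s * q ^ a) (s * q ^ b)

    -- ∑ₖ sᵏ q^((a + b) k² / 2 + (b - a) k / 2), for s = ±1.
    θ : Carrier → ℕ → ℕ → Carrier
    θ s a b = ΣZ N (thetaTerm s a b)

    ψ : ℕ → ℕ → Carrier
    ψ = θ 1#

    [sq^a]^n : ∀ s a n → (s * q ^ a) ^ n ≈ s ^ n * q ^ (a ℕ.* n)
    [sq^a]^n s a n = trans (^-distrib-* s (q ^ a) n) (*-congˡ (^-assocʳ q a n))

    nilpotent : ∀ s a → 1 ℕ.≤ a → ∀ n → suc N ℕ.≤ n → (s * q ^ a) ^ n ≈ 0#
    nilpotent s (suc a) 1≤a n N<n = trans ([sq^a]^n s (suc a) n)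
      (trans (*-congˡ (q^≈0 (suc a ℕ.* n) (ℕ.≤-trans N<n (ℕ.m≤m+n n (a ℕ.* n))))) (zeroʳ _))

    thetaTerm-vanishes : ∀ s {a b} → 1 ℕ.≤ a → 1 ℕ.≤ b → VanishesFrom (suc N) (thetaTerm s a b)
    thetaTerm-vanishes s {a} {b} 1≤a 1≤b =
      term-vanishes (s * q ^ a) (s * q ^ b) N (nilpotent s a 1≤a) (nilpotent s b 1≤b)

    thetaTerm-exp : ∀ s a b k → thetaTerm s a b k ≈ s ^ signExp k * q ^ thetaExp a b k
    thetaTerm-exp s a b k = begin
      (s * q ^ a) ^ T (ℤ.- k) * (s * q ^ b) ^ T k
        ≈⟨ *-cong ([sq^a]^n s a (T (ℤ.- k))) ([sq^a]^n s b (T k)) ⟩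
      s ^ T (ℤ.- k) * q ^ (a ℕ.* T (ℤ.- k)) * (s ^ T k * q ^ (b ℕ.* T k))
        ≈⟨ solve 4 (λ x y z w → x :* y :* (z :* w) := x :* z :* (y :* w)) refl _ _ _ _ ⟩
      s ^ T (ℤ.- k) * s ^ T k * (q ^ (a ℕ.* T (ℤ.- k)) * q ^ (b ℕ.* T k))
        ≈⟨ *-cong (^-homo-* s (T (ℤ.- k)) (T k)) (^-homo-* q (a ℕ.* T (ℤ.- k)) (b ℕ.* T k)) ⟨
      s ^ signExp k * q ^ thetaExp a b k
        ∎

    thetaTerm-* : ∀ s a b c d k l → thetaTerm s a b k * thetaTerm s c d l
      ≈ s ^ (signExp k ℕ.+ signExp l) * q ^ (thetaExp a b k ℕ.+ thetaExp c d l)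
    thetaTerm-* s a b c d k l = begin
      thetaTerm s a b k * thetaTerm s c d l
        ≈⟨ *-cong (thetaTerm-exp s a b k) (thetaTerm-exp s c d l) ⟩
      s ^ signExp k * q ^ thetaExp a b k * (s ^ signExp l * q ^ thetaExp c d l)
        ≈⟨ solve 4 (λ x y z w → x :* y :* (z :* w) := x :* z :* (y :* w)) refl _ _ _ _ ⟩
      s ^ signExp k * s ^ signExp l * (q ^ thetaExp a b k * q ^ thetaExp c d l)
        ≈⟨ *-cong (^-homo-* s (signExp k) (signExp l)) (^-homo-* q (thetaExp a b k) (thetaExp c d l)) ⟨
      s ^ (signExp k ℕ.+ signExp l) * q ^ (thetaExp a b k ℕ.+ thetaExp c d l)
        ∎

    ψTerm-* : ∀ a b c d k l →
              thetaTerm 1# a b k * thetaTerm 1# c d l ≈ q ^ (thetaExp a b k ℕ.+ thetaExp c d l)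
    ψTerm-* a b c d k l = trans (thetaTerm-* 1# a b c d k l) (trans (*-congʳ (1^n≈1 (signExp k ℕ.+ signExp l))) (*-identityˡ _))

    θ-comm : ∀ s a b → θ s a b ≈ θ s b a
    θ-comm s a b = trans
      (ΣZ-cong N λ k _ → trans (*-comm _ _) (*-congʳ (^-congʳ (s * q ^ b) (≡.cong T (≡.sym (ℤ.neg-involutive k))))))
      (ΣZ-neg N (thetaTerm s b a))

    module _ {s : Carrier} {e h g : ℕ} (s²≈1 : s * s ≈ 1#) (1≤e : 1 ℕ.≤ e) (1≤h : 1 ℕ.≤ h) (1≤g : 1 ℕ.≤ g) where

      private
        a₁ = e ℕ.+ h
        b₁ = e ℕ.+ g
        b₂ = e ℕ.+ h ℕ.+ g
        a₃ = e ℕ.+ e ℕ.+ h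
        b₃ = e ℕ.+ e ℕ.+ h ℕ.+ g ℕ.+ g
        a₄ = e ℕ.+ e ℕ.+ h ℕ.+ h ℕ.+ g
        b₄ = e ℕ.+ e ℕ.+ g
        a₅ = e ℕ.+ e ℕ.+ e ℕ.+ e ℕ.+ h ℕ.+ h ℕ.+ g
        b₆ = e ℕ.+ e ℕ.+ e ℕ.+ e ℕ.+ h ℕ.+ g ℕ.+ g

        1≤-+ʳ : ∀ {m} n → 1 ℕ.≤ m → 1 ℕ.≤ m ℕ.+ n
        1≤-+ʳ n 1≤m = ℕ.≤-trans 1≤m (ℕ.m≤m+n _ n)

        1≤-+ˡ : ∀ {m} n → 1 ℕ.≤ m → 1 ℕ.≤ n ℕ.+ m
        1≤-+ˡ n 1≤m = ℕ.≤-trans 1≤m (ℕ.m≤n+m _ n)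

        even : ∀ i j → thetaTerm s a₁ b₁ (i ℤ.+ j) * thetaTerm s e b₂ (i ℤ.- j)
                     ≈ 1# * (thetaTerm 1# a₃ b₃ i * thetaTerm 1# a₄ b₄ j)
        even i j = begin
          thetaTerm s a₁ b₁ (i ℤ.+ j) * thetaTerm s e b₂ (i ℤ.- j)
            ≈⟨ thetaTerm-* s a₁ b₁ e b₂ (i ℤ.+ j) (i ℤ.- j) ⟩
          s ^ (signExp (i ℤ.+ j) ℕ.+ signExp (i ℤ.- j)) * q ^ (thetaExp a₁ b₁ (i ℤ.+ j) ℕ.+ thetaExp e b₂ (i ℤ.- j))
            ≈⟨ *-cong (trans (^-congʳ s (signExp-even i j)) (x^[n+n]≈1 s²≈1 (signExp i ℕ.+ signExp j))) (^-congʳ q (thetaExp-even e h g i j)) ⟩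
          1# * q ^ (thetaExp a₃ b₃ i ℕ.+ thetaExp a₄ b₄ j)
            ≈⟨ *-congˡ (ψTerm-* a₃ b₃ a₄ b₄ i j) ⟨
          1# * (thetaTerm 1# a₃ b₃ i * thetaTerm 1# a₄ b₄ j)
            ∎

        odd : ∀ i j → thetaTerm s a₁ b₁ (i ℤ.+ j) * thetaTerm s e b₂ (ℤ.- (+ 1) ℤ.+ (i ℤ.- j))
                    ≈ s * q ^ e * (thetaTerm 1# a₅ g i * thetaTerm 1# h b₆ j)
        odd i j = begin
          thetaTerm s a₁ b₁ (i ℤ.+ j) * thetaTerm s e b₂ l
            ≈⟨ thetaTerm-* s a₁ b₁ e b₂ (i ℤ.+ j) l ⟩
          s ^ (signExp (i ℤ.+ j) ℕ.+ signExp l) * q ^ (thetaExp a₁ b₁ (i ℤ.+ j) ℕ.+ thetaExp e b₂ l)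
            ≈⟨ *-cong (trans (^-congʳ s (signExp-odd i j)) (trans (*-congˡ (x^[n+n]≈1 s²≈1 (T (ℤ.- i) ℕ.+ T j ℕ.+ (T (ℤ.- i) ℕ.+ T j)))) (*-identityʳ s)))
                      (^-congʳ q (thetaExp-odd e h g i j)) ⟩
          s * q ^ (e ℕ.+ (thetaExp a₅ g i ℕ.+ thetaExp h b₆ j))
            ≈⟨ *-congˡ (^-homo-* q e (thetaExp a₅ g i ℕ.+ thetaExp h b₆ j)) ⟩
          s * (q ^ e * q ^ (thetaExp a₅ g i ℕ.+ thetaExp h b₆ j))
            ≈⟨ *-assoc _ _ _ ⟨
          s * q ^ e * q ^ (thetaExp a₅ g i ℕ.+ thetaExp h b₆ j)
            ≈⟨ *-congˡ (ψTerm-* a₅ g h b₆ i j) ⟨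
          s * q ^ e * (thetaTerm 1# a₅ g i * thetaTerm 1# h b₆ j)
            ∎
          where l = ℤ.- (+ 1) ℤ.+ (i ℤ.- j)

        collect : ∀ x a b c d {f : ℤ → ℤ → Carrier} → 1 ℕ.≤ c → 1 ℕ.≤ d →
                  (∀ i j → f i j ≈ x * (thetaTerm 1# a b i * thetaTerm 1# c d j)) →
                  ΣZ N (λ i → ΣZ (N ℕ.+ N) (f i)) ≈ x * (ψ a b * ψ c d)
        collect x a b c d 1≤c 1≤d f≈ = trans
          (ΣZ-cong N λ i _ → ΣZ-cong (N ℕ.+ N) λ j _ → f≈ i j)
          (trans (ΣZ-separate N (N ℕ.+ N) x (thetaTerm 1# a b) (thetaTerm 1# c d))
          (*-congˡ (*-congˡ (ΣZ-extend (N ℕ.+ N) (thetaTerm-vanishes 1# 1≤c 1≤d) (ℕ.m≤m+n N N)))))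

      -- Ramanujan's expansion of f(a, b) f(c, d) for a b = c d. The sign survives only in the
      -- coefficient of the odd part, so signed and unsigned products expand in the same series `ψ`.
      θ-product : θ s a₁ b₁ * θ s e b₂ ≈ 1# * (ψ a₃ b₃ * ψ a₄ b₄) + s * q ^ e * (ψ a₅ g * ψ h b₆)
      θ-product = trans
        (ΣZ-*-ΣZ (thetaTerm-vanishes s (1≤-+ʳ h 1≤e) (1≤-+ʳ g 1≤e)) (thetaTerm-vanishes s 1≤e (1≤-+ˡ (e ℕ.+ h) 1≤g)))
        (+-cong
          (collect 1# a₃ b₃ a₄ b₄ (1≤-+ˡ (e ℕ.+ e ℕ.+ h ℕ.+ h) 1≤g) (1≤-+ˡ (e ℕ.+ e) 1≤g) even)
          (collect (s * q ^ e) a₅ g h b₆ 1≤h (1≤-+ˡ (e ℕ.+ e ℕ.+ e ℕ.+ e ℕ.+ h ℕ.+ g) 1≤g) odd))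

    -- t plays the role of -1.
    module Signed (t : Carrier) (1+t≈0 : 1# + t ≈ 0#) where

      private
        1*1≈1 = *-identityˡ 1#
        pos : ∀ {n} → 1 ℕ.≤ suc n
        pos = s≤s z≤n

      -- The two four-theta relations

      t²≈1 : t * t ≈ 1#
      t²≈1 = begin
        t * t                    ≈⟨ +-identityˡ _ ⟨
        0# + t * t               ≈⟨ +-congʳ 1+t≈0 ⟨
        1# + t + t * t           ≈⟨ solve 1 (λ t → con 1 :+ t :+ t :* t := con 1 :+ t :* (con 1 :+ t)) refl t ⟩
        1# + t * (1# + t)        ≈⟨ +-congˡ (trans (*-congˡ 1+t≈0) (zeroʳ t)) ⟩
        1# + 0#                  ≈⟨ +-identityʳ 1# ⟩
        1#                       ∎

      -- The Plücker relation between the 2 × 2 minors of a 2 × 4 matrix with columns (A , A′), (W , W′), (Y , Y′), (Z , Z′).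
      plücker₁ : ∀ A A′ W W′ Y Y′ Z Z′ →
        (1# * (A * W) + 1# * q ^ 5 * (A′ * W′)) * (1# * (Z′ * Y′) + 1# * q ^ 1 * (Z * Y))
        ≈ q * ((1# * (A * Z) + 1# * q ^ 3 * (A′ * Z′)) * (1# * (Y * W) + 1# * q ^ 1 * (Y′ * W′)))
          + (1# * (A * Y′) + t * q ^ 4 * (A′ * Y)) * (1# * (Z′ * W) + t * q ^ 2 * (Z * W′))
      plücker₁ A A′ W W′ Y Y′ Z Z′ = begin
        _ ≈⟨ solve 9 (λ q A A′ W W′ Y Y′ Z Z′ →
               (con 1 :* (A :* W) :+ con 1 :* q :^ 5 :* (A′ :* W′)) :* (con 1 :* (Z′ :* Y′) :+ con 1 :* q :^ 1 :* (Z :* Y))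
               := q :* (A :* W :* Z :* Y) :+ q :^ 5 :* (A′ :* W′ :* Z′ :* Y′)
                  :+ A :* W :* Z′ :* Y′ :+ con 0 :* (q :^ 2 :* (A :* Z :* Y′ :* W′) :+ q :^ 4 :* (A′ :* Z′ :* Y :* W))
                  :+ con 1 :* (q :^ 6 :* (A′ :* W′ :* Z :* Y))) refl q A A′ W W′ Y Y′ Z Z′ ⟩
        -- To the solver t is a free variable. The coefficients `con 0` and `con 1` above hold the
        -- places of 1 + t and t * t, which are substituted here.
        _ ≈⟨ +-cong (+-congˡ (*-congʳ 1+t≈0)) (*-congʳ t²≈1) ⟨
        _ ≈⟨ solve 10 (λ q t A A′ W W′ Y Y′ Z Z′ →
               q :* (A :* W :* Z :* Y) :+ q :^ 5 :* (A′ :* W′ :* Z′ :* Y′)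
                  :+ A :* W :* Z′ :* Y′ :+ (con 1 :+ t) :* (q :^ 2 :* (A :* Z :* Y′ :* W′) :+ q :^ 4 :* (A′ :* Z′ :* Y :* W))
                  :+ t :* t :* (q :^ 6 :* (A′ :* W′ :* Z :* Y))
               := q :* ((con 1 :* (A :* Z) :+ con 1 :* q :^ 3 :* (A′ :* Z′)) :* (con 1 :* (Y :* W) :+ con 1 :* q :^ 1 :* (Y′ :* W′)))
                  :+ (con 1 :* (A :* Y′) :+ t :* q :^ 4 :* (A′ :* Y)) :* (con 1 :* (Z′ :* W) :+ t :* q :^ 2 :* (Z :* W′)))
             refl q t A A′ W W′ Y Y′ Z Z′ ⟩
        _ ∎

      weierstrass₁ :
        (θ 1# 9 15 * θ 1# 5 19) * (θ 1# 7 17 * θ 1# 1 23)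
        ≈ q * ((θ 1# 11 13 * θ 1# 3 21) * (θ 1# 5 19 * θ 1# 1 23)) + (θ t 10 14 * θ t 4 20) * (θ t 6 18 * θ t 2 22)
      weierstrass₁ = begin
        (θ 1# 9 15 * θ 1# 5 19) * (θ 1# 7 17 * θ 1# 1 23)
          -- For factors with indices a > b the parameters are e = b, h = a - b and g = 24 - a - b.
          ≈⟨ *-cong (θ-product {1#} {5} {4} {10} 1*1≈1 pos pos pos) (θ-product {1#} {1} {6} {16} 1*1≈1 pos pos pos) ⟩
        (1# * (A * W) + 1# * q ^ 5 * (A′ * W′)) * (1# * (Z′ * Y′) + 1# * q ^ 1 * (Z * Y))
          ≈⟨ plücker₁ A A′ W W′ Y Y′ Z Z′ ⟩
        q * ((1# * (A * Z) + 1# * q ^ 3 * (A′ * Z′)) * (1# * (Y * W) + 1# * q ^ 1 * (Y′ * W′)))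
          + (1# * (A * Y′) + t * q ^ 4 * (A′ * Y)) * (1# * (Z′ * W) + t * q ^ 2 * (Z * W′))
          ≈⟨ +-cong
               (*-congˡ (*-cong (θ-product {1#} {3} {8} {10} 1*1≈1 pos pos pos) (θ-product {1#} {1} {4} {18} 1*1≈1 pos pos pos)))
               (*-cong (θ-product {t} {4} {6} {10} t²≈1 pos pos pos) (θ-product {t} {2} {4} {16} t²≈1 pos pos pos)) ⟨
        q * ((θ 1# 11 13 * θ 1# 3 21) * (θ 1# 5 19 * θ 1# 1 23)) + (θ t 10 14 * θ t 4 20) * (θ t 6 18 * θ t 2 22)
          ∎
        where
        A  = ψ 14 34
        A′ = ψ 38 10
        W  = ψ 28 20
        W′ = ψ 4 44
        Y  = ψ 6 42
        Y′ = ψ 30 18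
        Z  = ψ 32 16
        Z′ = ψ 8 40

      -- The analogous relation with the two entries interchanged in the columns of `A` and `Y`. The
      -- minors for (`A` , `Y`) and (`Z` , `W`) are the same as in `plücker₁`, which is why both
      -- four-theta relations contain [2][4][6][10].
      plücker₂ : ∀ A A′ W W′ Y Y′ Z Z′ →
        (1# * (Z * Y′) + 1# * q ^ 5 * (Z′ * Y)) * (1# * (A′ * W) + 1# * q ^ 3 * (A * W′))
          + q * ((1# * (A * Y′) + t * q ^ 4 * (A′ * Y)) * (1# * (Z′ * W) + t * q ^ 2 * (Z * W′)))
        ≈ (1# * (Y′ * W) + 1# * q ^ 7 * (Y * W′)) * (1# * (A′ * Z) + 1# * q ^ 1 * (A * Z′))
      plücker₂ A A′ W W′ Y Y′ Z Z′ = begin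
        _ ≈⟨ solve 10 (λ q t A A′ W W′ Y Y′ Z Z′ →
               (con 1 :* (Z :* Y′) :+ con 1 :* q :^ 5 :* (Z′ :* Y)) :* (con 1 :* (A′ :* W) :+ con 1 :* q :^ 3 :* (A :* W′))
                 :+ q :* ((con 1 :* (A :* Y′) :+ t :* q :^ 4 :* (A′ :* Y)) :* (con 1 :* (Z′ :* W) :+ t :* q :^ 2 :* (Z :* W′)))
               := Z :* Y′ :* A′ :* W :+ q :^ 8 :* (Z′ :* Y :* A :* W′) :+ q :* (A :* Y′ :* Z′ :* W)
                 :+ (con 1 :+ t) :* (q :^ 3 :* (Z :* Y′ :* A :* W′) :+ q :^ 5 :* (Z′ :* Y :* A′ :* W))
                 :+ t :* t :* (q :^ 7 :* (A′ :* Y :* Z :* W′))) refl q t A A′ W W′ Y Y′ Z Z′ ⟩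
        _ ≈⟨ +-cong (+-congˡ (*-congʳ 1+t≈0)) (*-congʳ t²≈1) ⟩
        _ ≈⟨ solve 9 (λ q A A′ W W′ Y Y′ Z Z′ →
               Z :* Y′ :* A′ :* W :+ q :^ 8 :* (Z′ :* Y :* A :* W′) :+ q :* (A :* Y′ :* Z′ :* W)
                 :+ con 0 :* (q :^ 3 :* (Z :* Y′ :* A :* W′) :+ q :^ 5 :* (Z′ :* Y :* A′ :* W))
                 :+ con 1 :* (q :^ 7 :* (A′ :* Y :* Z :* W′))
               := (con 1 :* (Y′ :* W) :+ con 1 :* q :^ 7 :* (Y :* W′)) :* (con 1 :* (A′ :* Z) :+ con 1 :* q :^ 1 :* (A :* Z′)))
               refl q A A′ W W′ Y Y′ Z Z′ ⟩
        _ ∎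

      weierstrass₂ :
        (θ 1# 11 13 * θ 1# 5 19) * (θ 1# 7 17 * θ 1# 3 21) + q * ((θ t 10 14 * θ t 4 20) * (θ t 6 18 * θ t 2 22))
        ≈ (θ 1# 11 13 * θ 1# 7 17) * (θ 1# 9 15 * θ 1# 1 23)
      weierstrass₂ = begin
        (θ 1# 11 13 * θ 1# 5 19) * (θ 1# 7 17 * θ 1# 3 21) + q * ((θ t 10 14 * θ t 4 20) * (θ t 6 18 * θ t 2 22))
          ≈⟨ +-cong
               (*-cong
                 (trans (θ-product {1#} {5} {6} {8} 1*1≈1 pos pos pos)
                   -- Some series come out of `θ-product` with k reversed; `θ-comm` restores the
                   -- orientation of the eight series named below.
                   (+-cong (*-congˡ (*-congʳ (θ-comm 1# 16 32))) (*-congˡ (*-congʳ (θ-comm 1# 40 8)))))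
                 (trans (θ-product {1#} {3} {4} {14} 1*1≈1 pos pos pos)
                   (+-cong (*-congˡ (*-congʳ (θ-comm 1# 10 38))) (*-congˡ (*-congʳ (θ-comm 1# 34 14))))))
               (*-congˡ (*-cong (θ-product {t} {4} {6} {10} t²≈1 pos pos pos) (θ-product {t} {2} {4} {16} t²≈1 pos pos pos))) ⟩
        (1# * (Z * Y′) + 1# * q ^ 5 * (Z′ * Y)) * (1# * (A′ * W) + 1# * q ^ 3 * (A * W′))
          + q * ((1# * (A * Y′) + t * q ^ 4 * (A′ * Y)) * (1# * (Z′ * W) + t * q ^ 2 * (Z * W′)))
          ≈⟨ plücker₂ A A′ W W′ Y Y′ Z Z′ ⟩
        (1# * (Y′ * W) + 1# * q ^ 7 * (Y * W′)) * (1# * (A′ * Z) + 1# * q ^ 1 * (A * Z′))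
          ≈⟨ *-cong
               (trans (θ-product {1#} {7} {4} {6} 1*1≈1 pos pos pos)
                 (+-cong (*-congˡ (*-congʳ (θ-comm 1# 18 30))) (*-congˡ (*-congʳ (θ-comm 1# 42 6)))))
               (trans (θ-product {1#} {1} {8} {14} 1*1≈1 pos pos pos)
                 (+-cong (*-congˡ (*-congʳ (θ-comm 1# 10 38))) (*-congˡ (*-congʳ (θ-comm 1# 34 14))))) ⟨
        (θ 1# 11 13 * θ 1# 7 17) * (θ 1# 9 15 * θ 1# 1 23)
          ∎
        where
        A  = ψ 14 34
        A′ = ψ 38 10
        W  = ψ 28 20
        W′ = ψ 4 44
        Y  = ψ 6 42
        Y′ = ψ 30 18
        Z  = ψ 32 16
        Z′ = ψ 8 40

      -- Truncated infinite products in the bases q^24 and q^48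

      private
        L = suc N ℕ.+ suc N

      -- F s r = (-s q^r; q^24)_∞ and E r = (q^r; q^48)_∞.
      F : Carrier → ℕ → Carrier
      F s r = ∏ L (λ i → 1# + s * q ^ (r ℕ.+ i ℕ.* 24))

      E : ℕ → Carrier
      E r = ∏ (suc N) (λ i → 1# + t * q ^ (r ℕ.+ i ℕ.* 48))

      -- The truncation of 1/(q^24; q^24)_∞.
      C : Carrier
      C = gauss (q ^ 24) (suc N) (suc N)

      -- The base (s q^a)(s q^b) of the triple product is q^24 whatever the sign and the index, so
      -- the same `C` occurs every time.
      F-*-F : ∀ {s} → s * s ≈ 1# → ∀ a b → 1 ℕ.≤ a → 1 ℕ.≤ b → a ℕ.+ b ≡ 24 → F s a * F s b ≈ C * θ s a b
      F-*-F {s} s²≈1 a b 1≤a 1≤b a+b≡24 = begin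
        F s a * F s b
          ≈⟨ *-cong (∏-cong L (factor a)) (∏-cong L (factor b)) ⟩
        ∏ L (λ i → 1# + s * q ^ a * Q ^ i) * ∏ L (λ i → 1# + s * q ^ b * Q ^ i)
          ≈⟨ jacobi (s * q ^ a) (s * q ^ b) N (nilpotent s a 1≤a) (nilpotent s b 1≤b) ⟩
        gauss Q (suc N) (suc N) * ΣZ L (term (s * q ^ a) (s * q ^ b))
          ≈⟨ *-cong (gauss-cong Q≈q^24 (suc N) (suc N))
               (ΣZ-extend L (thetaTerm-vanishes s 1≤a 1≤b) (ℕ.≤-trans (ℕ.n≤1+n N) (ℕ.m≤m+n (suc N) (suc N)))) ⟩
        C * θ s a b
          ∎
        where
        Q = s * q ^ a * (s * q ^ b)
        Q≈q^24 : Q ≈ q ^ 24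
        Q≈q^24 = begin
          s * q ^ a * (s * q ^ b)   ≈⟨ Monomial.solve 3 (λ s x y → (s ⊕ x) ⊕ (s ⊕ y)
                                         ⊜ (s ⊕ s) ⊕ (x ⊕ y)) refl s (q ^ a) (q ^ b) ⟩
          s * s * (q ^ a * q ^ b)   ≈⟨ *-cong s²≈1 (sym (^-homo-* q a b)) ⟩
          1# * q ^ (a ℕ.+ b)        ≈⟨ *-identityˡ _ ⟩
          q ^ (a ℕ.+ b)             ≈⟨ ^-congʳ q a+b≡24 ⟩
          q ^ 24                    ∎
        factor : ∀ r i → 1# + s * q ^ (r ℕ.+ i ℕ.* 24) ≈ 1# + s * q ^ r * Q ^ i
        factor r i = +-congˡ (begin
          s * q ^ (r ℕ.+ i ℕ.* 24)          ≈⟨ *-congˡ (^-homo-* q r (i ℕ.* 24)) ⟩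
          s * (q ^ r * q ^ (i ℕ.* 24))      ≈⟨ *-assoc _ _ _ ⟨
          s * q ^ r * q ^ (i ℕ.* 24)        ≈⟨ *-congˡ (^-congʳ q (ℕ.*-comm i 24)) ⟩
          s * q ^ r * q ^ (24 ℕ.* i)        ≈⟨ *-congˡ (^-assocʳ q 24 i) ⟨
          s * q ^ r * (q ^ 24) ^ i          ≈⟨ *-congˡ (^-congˡ i Q≈q^24) ⟨
          s * q ^ r * Q ^ i                 ∎)

      -- An exact identity of finite products: the 2(N + 1) factors of `F` separate by the parity of
      -- i into N + 1 factors each.
      F-split : ∀ r → F t r ≈ E r * E (24 ℕ.+ r)
      F-split r = trans (∏-double (suc N) _) (*-cong
        (∏-cong (suc N) λ i → +-congˡ (*-congˡ (^-congʳ q (even r i))))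
        (∏-cong (suc N) λ i → +-congˡ (*-congˡ (^-congʳ q (odd r i)))))
        where
        even : ∀ r i → r ℕ.+ (i ℕ.+ i) ℕ.* 24 ≡ r ℕ.+ i ℕ.* 48
        even = ℕ-RingSolver.solve-∀
        odd : ∀ r i → r ℕ.+ suc (i ℕ.+ i) ℕ.* 24 ≡ 24 ℕ.+ r ℕ.+ i ℕ.* 48
        odd = ℕ-RingSolver.solve-∀

      -- Factorwise (1 + x)(1 - x) = 1 - x². This gives 2(N + 1) factors in base q^48, and those
      -- with i > N are 1 by nilpotency.
      F-square : ∀ r → F 1# r * F t r ≈ E (r ℕ.+ r)
      F-square r = begin
        F 1# r * F t r
          ≈⟨ ∏-* L _ _ ⟨
        ∏ L (λ i → (1# + 1# * q ^ (r ℕ.+ i ℕ.* 24)) * (1# + t * q ^ (r ℕ.+ i ℕ.* 24)))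
          ≈⟨ ∏-cong L factor ⟩
        ∏ L (λ i → 1# + t * q ^ (r ℕ.+ r ℕ.+ i ℕ.* 48))
          ≈⟨ ∏-extend L (λ i N<i → trans (+-congˡ (trans (*-congˡ (q^≈0 _ (far i N<i))) (zeroʳ t))) (+-identityʳ 1#)) (ℕ.m≤m+n (suc N) (suc N)) ⟩
        E (r ℕ.+ r)
          ∎
        where
        far : ∀ i → suc N ℕ.≤ i → suc N ℕ.≤ r ℕ.+ r ℕ.+ i ℕ.* 48
        far i N<i = ℕ.≤-trans N<i (ℕ.≤-trans (ℕ.m≤m*n i 48) (ℕ.m≤n+m (i ℕ.* 48) (r ℕ.+ r)))
        exponent : ∀ r i → (r ℕ.+ i ℕ.* 24) ℕ.+ (r ℕ.+ i ℕ.* 24) ≡ r ℕ.+ r ℕ.+ i ℕ.* 48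
        exponent = ℕ-RingSolver.solve-∀
        factor : ∀ i → (1# + 1# * q ^ (r ℕ.+ i ℕ.* 24)) * (1# + t * q ^ (r ℕ.+ i ℕ.* 24))
                     ≈ 1# + t * q ^ (r ℕ.+ r ℕ.+ i ℕ.* 48)
        factor i = begin
          (1# + 1# * x) * (1# + t * x)
            ≈⟨ solve 2 (λ t x → (con 1 :+ con 1 :* x) :* (con 1 :+ t :* x) := con 1 :+ (con 1 :+ t) :* x :+ t :* (x :* x)) refl t x ⟩
          1# + (1# + t) * x + t * (x * x)
            ≈⟨ +-cong (trans (+-congˡ (trans (*-congʳ 1+t≈0) (zeroˡ x))) (+-identityʳ 1#))
                 (*-congˡ (trans (sym (^-homo-* q (r ℕ.+ i ℕ.* 24) (r ℕ.+ i ℕ.* 24))) (^-congʳ q (exponent r i)))) ⟩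
          1# + t * q ^ (r ℕ.+ r ℕ.+ i ℕ.* 48)
            ∎
          where x = q ^ (r ℕ.+ i ℕ.* 24)

      -- Cancellation of units

      Unipotent : Carrier → Set _
      Unipotent x = ∃ λ y → x ≈ 1# + q * y

      unipotent-* : ∀ {x y} → Unipotent x → Unipotent y → Unipotent (x * y)
      unipotent-* (x′ , x≈) (y′ , y≈) = x′ + y′ + q * (x′ * y′) , trans (*-cong x≈ y≈)
        (solve 3 (λ q x y → (con 1 :+ q :* x) :* (con 1 :+ q :* y) := con 1 :+ q :* (x :+ y :+ q :* (x :* y))) refl q x′ y′)

      unipotent-∏ : ∀ n {f} → (∀ i → Unipotent (f i)) → Unipotent (∏ n f)
      unipotent-∏ zero    u = 0# , solve 1 (λ q → con 1 := con 1 :+ q :* con 0) refl q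
      unipotent-∏ (suc n) u = unipotent-* (unipotent-∏ n u) (u n)

      unipotent-E : ∀ r → Unipotent (E (suc r))
      unipotent-E r = unipotent-∏ (suc N) λ i → t * q ^ (r ℕ.+ i ℕ.* 48) ,
        +-congˡ (solve 3 (λ t q x → t :* (q :* x) := q :* (t :* x)) refl t q _)

      x+t*x≈0 : ∀ x → x + t * x ≈ 0#
      x+t*x≈0 x = trans (solve 2 (λ t x → x :+ t :* x := (con 1 :+ t) :* x) refl t x) (trans (*-congʳ 1+t≈0) (zeroˡ x))

      -- The difference d = y - z satisfies x d = 0, that is d = -(q w) d. Iterating N + 1 times
      -- brings in a vanishing power of q.
      unipotent-cancel : ∀ {x} → Unipotent x → ∀ {y z} → x * y ≈ x * z → y ≈ z
      unipotent-cancel {x} (w , x≈) {y} {z} xy≈xz = begin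
        y              ≈⟨ +-identityʳ y ⟨
        y + 0#         ≈⟨ +-congˡ (x+t*x≈0 z) ⟨
        y + (z + t * z) ≈⟨ solve 3 (λ a b c → a :+ (b :+ c) := b :+ (a :+ c)) refl y z (t * z) ⟩
        z + d          ≈⟨ +-congˡ (trans (iterate (suc N)) (trans (*-congʳ vanish) (zeroˡ d))) ⟩
        z + 0#         ≈⟨ +-identityʳ z ⟩
        z              ∎
        where
        d = y + t * z
        qw = t * (q * w)
        xd≈0 : x * d ≈ 0#
        xd≈0 = begin
          x * (y + t * z)      ≈⟨ solve 4 (λ x y t z → x :* (y :+ t :* z) := x :* y :+ t :* (x :* z)) refl x y t z ⟩
          x * y + t * (x * z)  ≈⟨ +-congʳ xy≈xz ⟩
          x * z + t * (x * z)  ≈⟨ x+t*x≈0 (x * z) ⟩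
          0#                   ∎
        once : d ≈ qw * d
        once = begin
          d                              ≈⟨ +-identityʳ d ⟨
          d + 0#                         ≈⟨ +-congˡ (x+t*x≈0 (q * w * d)) ⟨
          d + (q * w * d + t * (q * w * d)) ≈⟨ solve 4 (λ d q w t → d :+ (q :* w :* d :+ t :* (q :* w :* d))
                                              := (con 1 :+ q :* w) :* d :+ t :* (q :* w) :* d) refl d q w t ⟩
          (1# + q * w) * d + qw * d      ≈⟨ +-congʳ (trans (*-congʳ (sym x≈)) xd≈0) ⟩
          0# + qw * d                    ≈⟨ +-identityˡ _ ⟩
          qw * d                         ∎
        iterate : ∀ n → d ≈ qw ^ n * d
        iterate zero    = sym (*-identityˡ d)
        iterate (suc n) = trans once (trans (*-congˡ (iterate n)) (sym (*-assoc _ _ _)))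
        vanish : qw ^ suc N ≈ 0#
        vanish = begin
          (t * (q * w)) ^ suc N    ≈⟨ ^-congˡ (suc N) (solve 3 (λ t q w → t :* (q :* w) := q :* (t :* w)) refl t q w) ⟩
          (q * (t * w)) ^ suc N    ≈⟨ ^-distrib-* q (t * w) (suc N) ⟩
          q ^ suc N * (t * w) ^ suc N ≈⟨ trans (*-congʳ (q^≈0 (suc N) ℕ.≤-refl)) (zeroˡ _) ⟩
          0#                       ∎

      -- P r = (q^r, q^(48-r); q^48)_∞ and O r = (q^r, q^(24-r); q^24)_∞.
      P : ℕ → Carrier
      P r = E r * E (48 ℕ.∸ r)

      O : ℕ → Carrier
      O r = P r * P (24 ℕ.∸ r)

      ∏E : List ℕ → Carrier
      ∏E = foldr (λ r x → E r * x) 1#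

      -- The factors common to S and T.
      K₁ K₂ : Carrier
      K₁ = O 1 * O 5 * (P 4 * P 20)
      K₂ = O 7 * O 11 * (P 4 * P 20)

      -- Product form of the four-theta relations

      G : Carrier → ℕ → Carrier
      G s r = F s r * F s (24 ℕ.∸ r)

      -- On numerals with a + b = 24 the right-hand side evaluates to `O a`, and that of `G-*-O` to
      -- `P (a + a)`; so both apply later without any rewriting of indices.
      G-O : ∀ a b → F t a * F t b ≈ E a * E (24 ℕ.+ b) * (E b * E (24 ℕ.+ a))
      G-O a b = trans (*-cong (F-split a) (F-split b))
        (Monomial.solve 4 (λ x x′ y y′ → (x ⊕ x′) ⊕ (y ⊕ y′) ⊜ (x ⊕ y′) ⊕ (y ⊕ x′)) refl _ _ _ _)

      G-*-O : ∀ a b → (F 1# a * F 1# b) * (E a * E (24 ℕ.+ b) * (E b * E (24 ℕ.+ a))) ≈ E (a ℕ.+ a) * E (b ℕ.+ b)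
      G-*-O a b = begin
        (F 1# a * F 1# b) * (E a * E (24 ℕ.+ b) * (E b * E (24 ℕ.+ a)))
          ≈⟨ *-congˡ (G-O a b) ⟨
        (F 1# a * F 1# b) * (F t a * F t b)
          ≈⟨ Monomial.solve 4 (λ x y x′ y′ → (x ⊕ y) ⊕ (x′ ⊕ y′) ⊜ (x ⊕ x′) ⊕ (y ⊕ y′)) refl _ _ _ _ ⟩
        (F 1# a * F t a) * (F 1# b * F t b)
          ≈⟨ *-cong (F-square a) (F-square b) ⟩
        E (a ℕ.+ a) * E (b ℕ.+ b)
          ∎

      C*[_,_,_,_] : ∀ {w x y z w′ x′ y′ z′} → w ≈ C * w′ → x ≈ C * x′ → y ≈ C * y′ → z ≈ C * z′ →
                    (w * x) * (y * z) ≈ C ^ 4 * ((w′ * x′) * (y′ * z′))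
      C*[_,_,_,_] {w′ = w} {x} {y} {z} p₁ p₂ p₃ p₄ = trans (*-cong (*-cong p₁ p₂) (*-cong p₃ p₄))
        (Monomial.solve 5 (λ c w x y z → ((c ⊕ w) ⊕ (c ⊕ x)) ⊕ ((c ⊕ y) ⊕ (c ⊕ z))
          ⊜ (c ⊕ (c ⊕ (c ⊕ (c ⊕ id)))) ⊕ ((w ⊕ x) ⊕ (y ⊕ z))) refl C w x y z)

      even-products : (G t 10 * G t 4) * (G t 6 * G t 2) ≈ C ^ 4 * ((θ t 10 14 * θ t 4 20) * (θ t 6 18 * θ t 2 22))
      even-products = C*[ F-*-F t²≈1 10 14 pos pos ≡.refl , F-*-F t²≈1 4 20 pos pos ≡.refl
                        , F-*-F t²≈1 6 18 pos pos ≡.refl , F-*-F t²≈1 2 22 pos pos ≡.refl ]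

      G₁ G₃ G₅ G₇ G₉ G₁₁ : Carrier
      G₁  = G 1# 1
      G₃  = G 1# 3
      G₅  = G 1# 5
      G₇  = G 1# 7
      G₉  = G 1# 9
      G₁₁ = G 1# 11

      G≈₁ : G₁ ≈ C * θ 1# 1 23
      G≈₁ = F-*-F 1*1≈1 1 23 pos pos ≡.refl
      G≈₃ : G₃ ≈ C * θ 1# 3 21
      G≈₃ = F-*-F 1*1≈1 3 21 pos pos ≡.refl
      G≈₅ : G₅ ≈ C * θ 1# 5 19
      G≈₅ = F-*-F 1*1≈1 5 19 pos pos ≡.refl
      G≈₇ : G₇ ≈ C * θ 1# 7 17
      G≈₇ = F-*-F 1*1≈1 7 17 pos pos ≡.refl
      G≈₉ : G₉ ≈ C * θ 1# 9 15
      G≈₉ = F-*-F 1*1≈1 9 15 pos pos ≡.refl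
      G≈₁₁ : G₁₁ ≈ C * θ 1# 11 13
      G≈₁₁ = F-*-F 1*1≈1 11 13 pos pos ≡.refl

      evens : (G t 10 * G t 4) * (G t 6 * G t 2) ≈ (O 10 * O 4) * (O 6 * O 2)
      evens = *-cong (*-cong (G-O 10 14) (G-O 4 20)) (*-cong (G-O 6 18) (G-O 2 22))

      product-identity₁ : (G₉ * G₅) * (G₇ * G₁) ≈ q * ((G₁₁ * G₃) * (G₅ * G₁)) + (O 10 * O 4) * (O 6 * O 2)
      product-identity₁ = begin
        (G₉ * G₅) * (G₇ * G₁)
          ≈⟨ C*[ G≈₉ , G≈₅ , G≈₇ , G≈₁ ] ⟩
        C ^ 4 * ((θ 1# 9 15 * θ 1# 5 19) * (θ 1# 7 17 * θ 1# 1 23))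
          ≈⟨ *-congˡ weierstrass₁ ⟩
        C ^ 4 * (q * ((θ 1# 11 13 * θ 1# 3 21) * (θ 1# 5 19 * θ 1# 1 23)) + (θ t 10 14 * θ t 4 20) * (θ t 6 18 * θ t 2 22))
          ≈⟨ solve 4 (λ c q x y → c :* (q :* x :+ y) := q :* (c :* x) :+ c :* y) refl (C ^ 4) q _ _ ⟩
        q * (C ^ 4 * ((θ 1# 11 13 * θ 1# 3 21) * (θ 1# 5 19 * θ 1# 1 23)))
          + C ^ 4 * ((θ t 10 14 * θ t 4 20) * (θ t 6 18 * θ t 2 22))
          ≈⟨ +-cong (*-congˡ C*[ G≈₁₁ , G≈₃ , G≈₅ , G≈₁ ]) even-products ⟨
        q * ((G₁₁ * G₃) * (G₅ * G₁)) + (G t 10 * G t 4) * (G t 6 * G t 2)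
          ≈⟨ +-congˡ evens ⟩
        q * ((G₁₁ * G₃) * (G₅ * G₁)) + (O 10 * O 4) * (O 6 * O 2)
          ∎

      product-identity₂ : (G₁₁ * G₅) * (G₇ * G₃) + q * ((O 10 * O 4) * (O 6 * O 2)) ≈ (G₁₁ * G₇) * (G₉ * G₁)
      product-identity₂ = begin
        (G₁₁ * G₅) * (G₇ * G₃) + q * ((O 10 * O 4) * (O 6 * O 2))
          ≈⟨ +-congˡ (*-congˡ evens) ⟨
        (G₁₁ * G₅) * (G₇ * G₃) + q * ((G t 10 * G t 4) * (G t 6 * G t 2))
          ≈⟨ +-cong C*[ G≈₁₁ , G≈₅ , G≈₇ , G≈₃ ] (*-congˡ even-products) ⟩
        C ^ 4 * ((θ 1# 11 13 * θ 1# 5 19) * (θ 1# 7 17 * θ 1# 3 21))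
          + q * (C ^ 4 * ((θ t 10 14 * θ t 4 20) * (θ t 6 18 * θ t 2 22)))
          ≈⟨ solve 4 (λ c q x y → c :* x :+ q :* (c :* y) := c :* (x :+ q :* y)) refl (C ^ 4) q _ _ ⟩
        C ^ 4 * ((θ 1# 11 13 * θ 1# 5 19) * (θ 1# 7 17 * θ 1# 3 21) + q * ((θ t 10 14 * θ t 4 20) * (θ t 6 18 * θ t 2 22)))
          ≈⟨ *-congˡ weierstrass₂ ⟩
        C ^ 4 * ((θ 1# 11 13 * θ 1# 7 17) * (θ 1# 9 15 * θ 1# 1 23))
          ≈⟨ C*[ G≈₁₁ , G≈₇ , G≈₉ , G≈₁ ] ⟨
        (G₁₁ * G₇) * (G₉ * G₁)
          ∎

      O₁ O₃ O₅ O₇ O₉ O₁₁ : Carrier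
      O₁  = O 1
      O₃  = O 3
      O₅  = O 5
      O₇  = O 7
      O₉  = O 9
      O₁₁ = O 11

      X : Carrier
      X = (O₁ * O₃) * (O₅ * O₇) * (O₉ * O₁₁)

      unipotent-P : ∀ {r r′} → 48 ℕ.∸ suc r ≡ suc r′ → Unipotent (P (suc r))
      unipotent-P {r} {r′} eq = unipotent-* (unipotent-E r) (≡.subst (λ x → Unipotent (E x)) (≡.sym eq) (unipotent-E r′))

      -- Multiplying by X completes every G r to G r * O r = P (2 r).
      reduced₁ : P 14 * P 18 * (O 3 * O 11) ≈ q * (P 6 * P 22 * (O 7 * O 9)) + X * (P 14 * O 4 * O 6 * P 22)
      -- `P 2` and `P 10` divide all three terms: they complete `G₁` and `G₅` in two of them, and
      -- are halves of `O 2` and `O 10` in the third.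
      reduced₁ = unipotent-cancel (unipotent-* (unipotent-P {1} ≡.refl) (unipotent-P {9} ≡.refl)) (begin
        P 2 * P 10 * (P 14 * P 18 * (O₃ * O₁₁))
          ≈⟨ Monomial.solve 6 (λ p₂ p₁₀ p₁₄ p₁₈ o₃ o₁₁ → (p₂ ⊕ p₁₀) ⊕ ((p₁₄ ⊕ p₁₈) ⊕ (o₃ ⊕ o₁₁))
               ⊜ ((p₁₈ ⊕ p₁₀) ⊕ (p₁₄ ⊕ p₂)) ⊕ (o₃ ⊕ o₁₁)) refl (P 2) (P 10) (P 14) (P 18) O₃ O₁₁ ⟩
        ((P 18 * P 10) * (P 14 * P 2)) * (O₃ * O₁₁)
          ≈⟨ *-congʳ (*-cong (*-cong (G-*-O 9 15) (G-*-O 5 19)) (*-cong (G-*-O 7 17) (G-*-O 1 23))) ⟨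
        (((G₉ * O₉) * (G₅ * O₅)) * ((G₇ * O₇) * (G₁ * O₁))) * (O₃ * O₁₁)
          ≈⟨ Monomial.solve 10 (λ g₁ g₅ g₇ g₉ o₁ o₃ o₅ o₇ o₉ o₁₁ →
               (((g₉ ⊕ o₉) ⊕ (g₅ ⊕ o₅)) ⊕ ((g₇ ⊕ o₇) ⊕ (g₁ ⊕ o₁))) ⊕ (o₃ ⊕ o₁₁)
               ⊜ (((o₁ ⊕ o₃) ⊕ (o₅ ⊕ o₇)) ⊕ (o₉ ⊕ o₁₁)) ⊕ ((g₉ ⊕ g₅) ⊕ (g₇ ⊕ g₁))) refl G₁ G₅ G₇ G₉ O₁ O₃ O₅ O₇ O₉ O₁₁ ⟩
        X * ((G₉ * G₅) * (G₇ * G₁))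
          ≈⟨ *-congˡ product-identity₁ ⟩
        X * (q * ((G₁₁ * G₃) * (G₅ * G₁)) + (O 10 * O 4) * (O 6 * O 2))
          ≈⟨ solve 4 (λ x q y z → x :* (q :* y :+ z) := q :* (x :* y) :+ x :* z) refl X q _ _ ⟩
        q * (X * ((G₁₁ * G₃) * (G₅ * G₁))) + X * ((O 10 * O 4) * (O 6 * O 2))
          ≈⟨ +-congʳ (*-congˡ (Monomial.solve 10 (λ g₁ g₃ g₅ g₁₁ o₁ o₃ o₅ o₇ o₉ o₁₁ →
               (((o₁ ⊕ o₃) ⊕ (o₅ ⊕ o₇)) ⊕ (o₉ ⊕ o₁₁)) ⊕ ((g₁₁ ⊕ g₃) ⊕ (g₅ ⊕ g₁))
               ⊜ (((g₁₁ ⊕ o₁₁) ⊕ (g₃ ⊕ o₃)) ⊕ ((g₅ ⊕ o₅) ⊕ (g₁ ⊕ o₁))) ⊕ (o₇ ⊕ o₉)) refl G₁ G₃ G₅ G₁₁ O₁ O₃ O₅ O₇ O₉ O₁₁)) ⟩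
        q * ((((G₁₁ * O₁₁) * (G₃ * O₃)) * ((G₅ * O₅) * (G₁ * O₁))) * (O₇ * O₉)) + X * ((O 10 * O 4) * (O 6 * O 2))
          ≈⟨ +-congʳ (*-congˡ (*-congʳ (*-cong (*-cong (G-*-O 11 13) (G-*-O 3 21)) (*-cong (G-*-O 5 19) (G-*-O 1 23))))) ⟩
        q * (((P 22 * P 6) * (P 10 * P 2)) * (O₇ * O₉)) + X * (((P 10 * P 14) * O 4) * (O 6 * (P 2 * P 22)))
          ≈⟨ solve 11 (λ q x p₂ p₆ p₁₀ p₁₄ p₂₂ o₄ o₆ o₇ o₉ →
               q :* (((p₂₂ :* p₆) :* (p₁₀ :* p₂)) :* (o₇ :* o₉)) :+ x :* (((p₁₀ :* p₁₄) :* o₄) :* (o₆ :* (p₂ :* p₂₂)))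
               := p₂ :* p₁₀ :* (q :* (p₆ :* p₂₂ :* (o₇ :* o₉)) :+ x :* (p₁₄ :* o₄ :* o₆ :* p₂₂)))
               refl q X (P 2) (P 6) (P 10) (P 14) (P 22) (O 4) (O 6) O₇ O₉ ⟩
        P 2 * P 10 * (q * (P 6 * P 22 * (O₇ * O₉)) + X * (P 14 * O 4 * O 6 * P 22))
          ∎)

      -- Here the common factors are `P 14` and `P 22`, coming from `G₇` and `G₁₁` and from the
      -- other halves of `O 10` and `O 2`.
      reduced₂ : P 6 * P 10 * (O 1 * O 9) + q * (X * (P 10 * O 4 * O 6 * P 2)) ≈ P 2 * P 18 * (O 3 * O 5)
      reduced₂ = unipotent-cancel (unipotent-* (unipotent-P {13} ≡.refl) (unipotent-P {21} ≡.refl)) (begin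
        P 14 * P 22 * (P 6 * P 10 * (O₁ * O₉) + q * (X * (P 10 * O 4 * O 6 * P 2)))
          ≈⟨ solve 11 (λ q x p₂ p₆ p₁₀ p₁₄ p₂₂ o₁ o₄ o₆ o₉ →
               p₁₄ :* p₂₂ :* (p₆ :* p₁₀ :* (o₁ :* o₉) :+ q :* (x :* (p₁₀ :* o₄ :* o₆ :* p₂)))
               := ((p₂₂ :* p₁₀) :* (p₁₄ :* p₆)) :* (o₁ :* o₉) :+ q :* (x :* (((p₁₀ :* p₁₄) :* o₄) :* (o₆ :* (p₂ :* p₂₂)))))
               refl q X (P 2) (P 6) (P 10) (P 14) (P 22) O₁ (O 4) (O 6) O₉ ⟩
        ((P 22 * P 10) * (P 14 * P 6)) * (O₁ * O₉) + q * (X * ((O 10 * O 4) * (O 6 * O 2)))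
          ≈⟨ +-congʳ (*-congʳ (*-cong (*-cong (G-*-O 11 13) (G-*-O 5 19)) (*-cong (G-*-O 7 17) (G-*-O 3 21)))) ⟨
        (((G₁₁ * O₁₁) * (G₅ * O₅)) * ((G₇ * O₇) * (G₃ * O₃))) * (O₁ * O₉) + q * (X * ((O 10 * O 4) * (O 6 * O 2)))
          ≈⟨ +-congʳ (Monomial.solve 10 (λ g₃ g₅ g₇ g₁₁ o₁ o₃ o₅ o₇ o₉ o₁₁ →
               (((g₁₁ ⊕ o₁₁) ⊕ (g₅ ⊕ o₅)) ⊕ ((g₇ ⊕ o₇) ⊕ (g₃ ⊕ o₃))) ⊕ (o₁ ⊕ o₉)
               ⊜ (((o₁ ⊕ o₃) ⊕ (o₅ ⊕ o₇)) ⊕ (o₉ ⊕ o₁₁)) ⊕ ((g₁₁ ⊕ g₅) ⊕ (g₇ ⊕ g₃))) refl G₃ G₅ G₇ G₁₁ O₁ O₃ O₅ O₇ O₉ O₁₁) ⟩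
        X * ((G₁₁ * G₅) * (G₇ * G₃)) + q * (X * ((O 10 * O 4) * (O 6 * O 2)))
          ≈⟨ solve 4 (λ x q y z → x :* y :+ q :* (x :* z) := x :* (y :+ q :* z)) refl X q _ _ ⟩
        X * ((G₁₁ * G₅) * (G₇ * G₃) + q * ((O 10 * O 4) * (O 6 * O 2)))
          ≈⟨ *-congˡ product-identity₂ ⟩
        X * ((G₁₁ * G₇) * (G₉ * G₁))
          ≈⟨ Monomial.solve 10 (λ g₁ g₇ g₉ g₁₁ o₁ o₃ o₅ o₇ o₉ o₁₁ →
               (((o₁ ⊕ o₃) ⊕ (o₅ ⊕ o₇)) ⊕ (o₉ ⊕ o₁₁)) ⊕ ((g₁₁ ⊕ g₇) ⊕ (g₉ ⊕ g₁))
               ⊜ (((g₁₁ ⊕ o₁₁) ⊕ (g₇ ⊕ o₇)) ⊕ ((g₉ ⊕ o₉) ⊕ (g₁ ⊕ o₁))) ⊕ (o₃ ⊕ o₅)) refl G₁ G₇ G₉ G₁₁ O₁ O₃ O₅ O₇ O₉ O₁₁ ⟩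
        (((G₁₁ * O₁₁) * (G₇ * O₇)) * ((G₉ * O₉) * (G₁ * O₁))) * (O₃ * O₅)
          ≈⟨ *-congʳ (*-cong (*-cong (G-*-O 11 13) (G-*-O 7 17)) (*-cong (G-*-O 9 15) (G-*-O 1 23))) ⟩
        ((P 22 * P 14) * (P 18 * P 2)) * (O₃ * O₅)
          ≈⟨ Monomial.solve 6 (λ p₂ p₁₄ p₁₈ p₂₂ o₃ o₅ → ((p₂₂ ⊕ p₁₄) ⊕ (p₁₈ ⊕ p₂)) ⊕ (o₃ ⊕ o₅)
               ⊜ (p₁₄ ⊕ p₂₂) ⊕ ((p₂ ⊕ p₁₈) ⊕ (o₃ ⊕ o₅))) refl (P 2) (P 14) (P 18) (P 22) O₃ O₅ ⟩
        P 14 * P 22 * (P 2 * P 18 * (O₃ * O₅))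
          ∎)

      -- Relations between the denominators of the generating functions

      ∏E-S₁ : ∏E S₁-residues ≈ (P 6 * P 22 * (O 7 * O 9)) * K₁
      ∏E-S₁ = Monomial.solve 24 (λ x47 x44 x43 x42 x41 x39 x33 x31 x29 x28 x26 x25 x23 x22 x20 x19 x17 x15 x9 x7 x6 x5 x4 x1 →
        x47 ⊕ (x44 ⊕ (x43 ⊕ (x42 ⊕ (x41 ⊕ (x39 ⊕ (x33 ⊕ (x31 ⊕ (x29 ⊕ (x28 ⊕ (x26 ⊕ (x25 ⊕ (x23 ⊕ (x22 ⊕ (x20 ⊕ (x19 ⊕ (x17 ⊕ (x15 ⊕ (x9 ⊕ (x7 ⊕ (x6 ⊕ (x5 ⊕ (x4 ⊕ (x1 ⊕ (id))))))))))))))))))))))))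
        ⊜ ((((x6 ⊕ x42) ⊕ (x22 ⊕ x26)) ⊕ (((x7 ⊕ x41) ⊕ (x17 ⊕ x31)) ⊕ ((x9 ⊕ x39) ⊕ (x15 ⊕ x33)))) ⊕ ((((x1 ⊕ x47) ⊕ (x23 ⊕ x25)) ⊕ ((x5 ⊕ x43) ⊕ (x19 ⊕ x29))) ⊕ ((x4 ⊕ x44) ⊕ (x20 ⊕ x28)))))
        refl (E 47) (E 44) (E 43) (E 42) (E 41) (E 39) (E 33) (E 31) (E 29) (E 28) (E 26) (E 25) (E 23) (E 22) (E 20) (E 19) (E 17) (E 15) (E 9) (E 7) (E 6) (E 5) (E 4) (E 1)

      ∏E-T₁ : ∏E T₁-residues ≈ (P 14 * P 18 * (O 3 * O 11)) * K₁
      ∏E-T₁ = Monomial.solve 24 (λ x47 x45 x44 x43 x37 x35 x34 x30 x29 x28 x27 x25 x23 x21 x20 x19 x18 x14 x13 x11 x5 x4 x3 x1 →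
        x47 ⊕ (x45 ⊕ (x44 ⊕ (x43 ⊕ (x37 ⊕ (x35 ⊕ (x34 ⊕ (x30 ⊕ (x29 ⊕ (x28 ⊕ (x27 ⊕ (x25 ⊕ (x23 ⊕ (x21 ⊕ (x20 ⊕ (x19 ⊕ (x18 ⊕ (x14 ⊕ (x13 ⊕ (x11 ⊕ (x5 ⊕ (x4 ⊕ (x3 ⊕ (x1 ⊕ (id))))))))))))))))))))))))
        ⊜ ((((x14 ⊕ x34) ⊕ (x18 ⊕ x30)) ⊕ (((x3 ⊕ x45) ⊕ (x21 ⊕ x27)) ⊕ ((x11 ⊕ x37) ⊕ (x13 ⊕ x35)))) ⊕ ((((x1 ⊕ x47) ⊕ (x23 ⊕ x25)) ⊕ ((x5 ⊕ x43) ⊕ (x19 ⊕ x29))) ⊕ ((x4 ⊕ x44) ⊕ (x20 ⊕ x28)))))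
        refl (E 47) (E 45) (E 44) (E 43) (E 37) (E 35) (E 34) (E 30) (E 29) (E 28) (E 27) (E 25) (E 23) (E 21) (E 20) (E 19) (E 18) (E 14) (E 13) (E 11) (E 5) (E 4) (E 3) (E 1)

      ∏E-S₂ : ∏E S₂-residues ≈ (P 2 * P 18 * (O 3 * O 5)) * K₂
      ∏E-S₂ = Monomial.solve 24 (λ x46 x45 x44 x43 x41 x37 x35 x31 x30 x29 x28 x27 x21 x20 x19 x18 x17 x13 x11 x7 x5 x4 x3 x2 →
        x46 ⊕ (x45 ⊕ (x44 ⊕ (x43 ⊕ (x41 ⊕ (x37 ⊕ (x35 ⊕ (x31 ⊕ (x30 ⊕ (x29 ⊕ (x28 ⊕ (x27 ⊕ (x21 ⊕ (x20 ⊕ (x19 ⊕ (x18 ⊕ (x17 ⊕ (x13 ⊕ (x11 ⊕ (x7 ⊕ (x5 ⊕ (x4 ⊕ (x3 ⊕ (x2 ⊕ (id))))))))))))))))))))))))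
        ⊜ ((((x2 ⊕ x46) ⊕ (x18 ⊕ x30)) ⊕ (((x3 ⊕ x45) ⊕ (x21 ⊕ x27)) ⊕ ((x5 ⊕ x43) ⊕ (x19 ⊕ x29)))) ⊕ ((((x7 ⊕ x41) ⊕ (x17 ⊕ x31)) ⊕ ((x11 ⊕ x37) ⊕ (x13 ⊕ x35))) ⊕ ((x4 ⊕ x44) ⊕ (x20 ⊕ x28)))))
        refl (E 46) (E 45) (E 44) (E 43) (E 41) (E 37) (E 35) (E 31) (E 30) (E 29) (E 28) (E 27) (E 21) (E 20) (E 19) (E 18) (E 17) (E 13) (E 11) (E 7) (E 5) (E 4) (E 3) (E 2)

      ∏E-T₂ : ∏E T₂-residues ≈ (P 6 * P 10 * (O 1 * O 9)) * K₂
      ∏E-T₂ = Monomial.solve 24 (λ x47 x44 x42 x41 x39 x38 x37 x35 x33 x31 x28 x25 x23 x20 x17 x15 x13 x11 x10 x9 x7 x6 x4 x1 →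
        x47 ⊕ (x44 ⊕ (x42 ⊕ (x41 ⊕ (x39 ⊕ (x38 ⊕ (x37 ⊕ (x35 ⊕ (x33 ⊕ (x31 ⊕ (x28 ⊕ (x25 ⊕ (x23 ⊕ (x20 ⊕ (x17 ⊕ (x15 ⊕ (x13 ⊕ (x11 ⊕ (x10 ⊕ (x9 ⊕ (x7 ⊕ (x6 ⊕ (x4 ⊕ (x1 ⊕ (id))))))))))))))))))))))))
        ⊜ ((((x6 ⊕ x42) ⊕ (x10 ⊕ x38)) ⊕ (((x1 ⊕ x47) ⊕ (x23 ⊕ x25)) ⊕ ((x9 ⊕ x39) ⊕ (x15 ⊕ x33)))) ⊕ ((((x7 ⊕ x41) ⊕ (x17 ⊕ x31)) ⊕ ((x11 ⊕ x37) ⊕ (x13 ⊕ x35))) ⊕ ((x4 ⊕ x44) ⊕ (x20 ⊕ x28)))))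
        refl (E 47) (E 44) (E 42) (E 41) (E 39) (E 38) (E 37) (E 35) (E 33) (E 31) (E 28) (E 25) (E 23) (E 20) (E 17) (E 15) (E 13) (E 11) (E 10) (E 9) (E 7) (E 6) (E 4) (E 1)

      denominators₁ : ∏E T₁-residues ≈ q * ∏E S₁-residues + ∏E S₁-residues * ∏E T₁-residues
      denominators₁ = begin
        ∏E T₁-residues
          ≈⟨ ∏E-T₁ ⟩
        P 14 * P 18 * (O 3 * O 11) * K₁
          ≈⟨ *-congʳ reduced₁ ⟩
        (q * (P 6 * P 22 * (O 7 * O 9)) + X * (P 14 * O 4 * O 6 * P 22)) * K₁
          -- With `O 4` and `O 6` unfolded into their `P` factors, the term containing `X` is
          -- precisely the product of the parts proper to S and T with one copy of `K₁`; the outer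
          -- `K₁` supplies the second copy.
          ≈⟨ solve 13 (λ q o₁ o₃ o₅ o₇ o₉ o₁₁ p₄ p₂₀ p₆ p₁₄ p₁₈ p₂₂ →
               let k = o₁ :* o₅ :* (p₄ :* p₂₀); s = p₆ :* p₂₂ :* (o₇ :* o₉) in
               (q :* s :+ ((o₁ :* o₃) :* (o₅ :* o₇) :* (o₉ :* o₁₁)) :* (p₁₄ :* (p₄ :* p₂₀) :* (p₆ :* p₁₈) :* p₂₂)) :* k
               := q :* (s :* k) :+ (s :* k) :* (p₁₄ :* p₁₈ :* (o₃ :* o₁₁) :* k))
               refl q O₁ O₃ O₅ O₇ O₉ O₁₁ (P 4) (P 20) (P 6) (P 14) (P 18) (P 22) ⟩
        q * (P 6 * P 22 * (O 7 * O 9) * K₁) + (P 6 * P 22 * (O 7 * O 9) * K₁) * (P 14 * P 18 * (O 3 * O 11) * K₁)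
          ≈⟨ +-cong (*-congˡ ∏E-S₁) (*-cong ∏E-S₁ ∏E-T₁) ⟨
        q * ∏E S₁-residues + ∏E S₁-residues * ∏E T₁-residues
          ∎

      denominators₂ : ∏E T₂-residues + q * (∏E S₂-residues * ∏E T₂-residues) ≈ ∏E S₂-residues
      denominators₂ = begin
        ∏E T₂-residues + q * (∏E S₂-residues * ∏E T₂-residues)
          ≈⟨ +-cong ∏E-T₂ (*-congˡ (*-cong ∏E-S₂ ∏E-T₂)) ⟩
        P 6 * P 10 * (O 1 * O 9) * K₂ + q * ((P 2 * P 18 * (O 3 * O 5) * K₂) * (P 6 * P 10 * (O 1 * O 9) * K₂))
          ≈⟨ solve 13 (λ q o₁ o₃ o₅ o₇ o₉ o₁₁ p₂ p₄ p₂₀ p₆ p₁₀ p₁₈ →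
               let k = o₇ :* o₁₁ :* (p₄ :* p₂₀); s = p₆ :* p₁₀ :* (o₁ :* o₉) in
               s :* k :+ q :* ((p₂ :* p₁₈ :* (o₃ :* o₅) :* k) :* (s :* k))
               := (s :+ q :* (((o₁ :* o₃) :* (o₅ :* o₇) :* (o₉ :* o₁₁)) :* (p₁₀ :* (p₄ :* p₂₀) :* (p₆ :* p₁₈) :* p₂))) :* k)
               refl q O₁ O₃ O₅ O₇ O₉ O₁₁ (P 2) (P 4) (P 20) (P 6) (P 10) (P 18) ⟩
        (P 6 * P 10 * (O 1 * O 9) + q * (X * (P 10 * O 4 * O 6 * P 2))) * K₂
          ≈⟨ *-congʳ reduced₂ ⟩
        P 2 * P 18 * (O 3 * O 5) * K₂
          ≈⟨ ∏E-S₂ ⟨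
        ∏E S₂-residues
          ∎

-- Formal operators on integer sequences, generated by the right shift and the negation.  Compared on the terms
-- 0, …, N only, they form the ring ℤ[q] / (q^(N+1)).
data Op : Set where
  𝟘 𝟙 𝕢 𝕥 : Op
  _⊕_ _⊗_ : Op → Op → Op

shift : (ℕ → ℤ) → ℕ → ℤ
shift f zero    = + 0
shift f (suc n) = f n

⟦_⟧ : Op → (ℕ → ℤ) → ℕ → ℤ
⟦ 𝟘 ⟧     f n = + 0
⟦ 𝟙 ⟧     f n = f n
⟦ 𝕢 ⟧     f n = shift f n
⟦ 𝕥 ⟧     f n = ℤ.- f n
⟦ a ⊕ b ⟧ f n = ⟦ a ⟧ f n ℤ.+ ⟦ b ⟧ f n
⟦ a ⊗ b ⟧ f n = ⟦ a ⟧ (⟦ b ⟧ f) n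

-- No operator looks ahead. Hence comparison on the terms 0, ..., N is respected by composition, and
-- a shifted operator sees strictly earlier terms only.
⟦⟧-causal : ∀ a {f g} n → (∀ m → m ℕ.≤ n → f m ≡ g m) → ⟦ a ⟧ f n ≡ ⟦ a ⟧ g n
⟦⟧-causal 𝟘       n       f≡g = ≡.refl
⟦⟧-causal 𝟙       n       f≡g = f≡g n ℕ.≤-refl
⟦⟧-causal 𝕢       zero    f≡g = ≡.refl
⟦⟧-causal 𝕢       (suc n) f≡g = f≡g n (ℕ.n≤1+n n)
⟦⟧-causal 𝕥       n       f≡g = ≡.cong ℤ.-_ (f≡g n ℕ.≤-refl)
⟦⟧-causal (a ⊕ b) n       f≡g = ≡.cong₂ ℤ._+_ (⟦⟧-causal a n f≡g) (⟦⟧-causal b n f≡g)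
⟦⟧-causal (a ⊗ b) n       f≡g =
  ⟦⟧-causal a n λ m m≤n → ⟦⟧-causal b m λ l l≤m → f≡g l (ℕ.≤-trans l≤m m≤n)

⟦⟧-cong : ∀ a {f g} → (∀ n → f n ≡ g n) → ∀ n → ⟦ a ⟧ f n ≡ ⟦ a ⟧ g n
⟦⟧-cong a f≡g n = ⟦⟧-causal a n λ m _ → f≡g m

⟦⟧-0 : ∀ a n → ⟦ a ⟧ (λ _ → + 0) n ≡ + 0
⟦⟧-0 𝟘       n       = ≡.refl
⟦⟧-0 𝟙       n       = ≡.refl
⟦⟧-0 𝕢       zero    = ≡.refl
⟦⟧-0 𝕢       (suc n) = ≡.refl
⟦⟧-0 𝕥       n       = ≡.refl
⟦⟧-0 (a ⊕ b) n       = ≡.cong₂ ℤ._+_ (⟦⟧-0 a n) (⟦⟧-0 b n)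
⟦⟧-0 (a ⊗ b) n       = ≡.trans (⟦⟧-cong a (⟦⟧-0 b) n) (⟦⟧-0 a n)

⟦⟧-+ : ∀ a f g n → ⟦ a ⟧ (λ m → f m ℤ.+ g m) n ≡ ⟦ a ⟧ f n ℤ.+ ⟦ a ⟧ g n
⟦⟧-+ 𝟘       f g n       = ≡.refl
⟦⟧-+ 𝟙       f g n       = ≡.refl
⟦⟧-+ 𝕢       f g zero    = ≡.refl
⟦⟧-+ 𝕢       f g (suc n) = ≡.refl
⟦⟧-+ 𝕥       f g n       = ℤ.neg-distrib-+ (f n) (g n)
⟦⟧-+ (a ⊕ b) f g n       = ≡.trans
  (≡.cong₂ ℤ._+_ (⟦⟧-+ a f g n) (⟦⟧-+ b f g n))
  (interchange (⟦ a ⟧ f n) (⟦ a ⟧ g n) (⟦ b ⟧ f n) (⟦ b ⟧ g n))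
⟦⟧-+ (a ⊗ b) f g n       = ≡.trans (⟦⟧-cong a (⟦⟧-+ b f g) n) (⟦⟧-+ a (⟦ b ⟧ f) (⟦ b ⟧ g) n)

⟦⟧-neg : ∀ a f n → ⟦ a ⟧ (λ m → ℤ.- f m) n ≡ ℤ.- ⟦ a ⟧ f n
⟦⟧-neg 𝟘       f n       = ≡.refl
⟦⟧-neg 𝟙       f n       = ≡.refl
⟦⟧-neg 𝕢       f zero    = ≡.refl
⟦⟧-neg 𝕢       f (suc n) = ≡.refl
⟦⟧-neg 𝕥       f n       = ≡.refl
⟦⟧-neg (a ⊕ b) f n       = ≡.trans (≡.cong₂ ℤ._+_ (⟦⟧-neg a f n) (⟦⟧-neg b f n))
                                   (≡.sym (ℤ.neg-distrib-+ (⟦ a ⟧ f n) (⟦ b ⟧ f n)))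
⟦⟧-neg (a ⊗ b) f n       = ≡.trans (⟦⟧-cong a (⟦⟧-neg b f) n) (⟦⟧-neg a (⟦ b ⟧ f) n)

⟦⟧-shift : ∀ a f n → ⟦ a ⟧ (shift f) n ≡ shift (⟦ a ⟧ f) n
⟦⟧-shift 𝟘       f zero    = ≡.refl
⟦⟧-shift 𝟘       f (suc n) = ≡.refl
⟦⟧-shift 𝟙       f n       = ≡.refl
⟦⟧-shift 𝕢       f n       = ≡.refl
⟦⟧-shift 𝕥       f zero    = ≡.refl
⟦⟧-shift 𝕥       f (suc n) = ≡.refl
⟦⟧-shift (a ⊕ b) f zero    = ≡.cong₂ ℤ._+_ (⟦⟧-shift a f zero) (⟦⟧-shift b f zero)
⟦⟧-shift (a ⊕ b) f (suc n) = ≡.cong₂ ℤ._+_ (⟦⟧-shift a f (suc n)) (⟦⟧-shift b f (suc n))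
⟦⟧-shift (a ⊗ b) f n       = ≡.trans (⟦⟧-cong a (⟦⟧-shift b f) n) (⟦⟧-shift a (⟦ b ⟧ f) n)

-- Arbitrary operators on sequences do not commute. These do because they are generated
-- syntactically, and every generator commutes with every operator.
⟦⟧-comm : ∀ a b f n → ⟦ a ⟧ (⟦ b ⟧ f) n ≡ ⟦ b ⟧ (⟦ a ⟧ f) n
⟦⟧-comm 𝟘        b f n = ≡.sym (⟦⟧-0 b n)
⟦⟧-comm 𝟙        b f n = ≡.refl
⟦⟧-comm 𝕢        b f n = ≡.sym (⟦⟧-shift b f n)
⟦⟧-comm 𝕥        b f n = ≡.sym (⟦⟧-neg b f n)
⟦⟧-comm (a ⊕ a′) b f n = ≡.trans (≡.cong₂ ℤ._+_ (⟦⟧-comm a b f n) (⟦⟧-comm a′ b f n))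
                                 (≡.sym (⟦⟧-+ b (⟦ a ⟧ f) (⟦ a′ ⟧ f) n))
⟦⟧-comm (a ⊗ a′) b f n = ≡.trans (⟦⟧-cong a (⟦⟧-comm a′ b f) n) (⟦⟧-comm a b (⟦ a′ ⟧ f) n)

residues : PartSet → ℕ → List ℕ
residues S n = filterᵇ S (applyDownFrom suc n)

module Truncation (N : ℕ) where

  infix 4 _∼_ _≃_

  _∼_ : (ℕ → ℤ) → (ℕ → ℤ) → Set
  f ∼ g = ∀ n → n ℕ.≤ N → f n ≡ g n

  record _≃_ (a b : Op) : Set where
    constructor mk≃
    field apply : ∀ f → ⟦ a ⟧ f ∼ ⟦ b ⟧ f

  open _≃_ public

  ⟦⟧-∼ : ∀ a {f g} → f ∼ g → ⟦ a ⟧ f ∼ ⟦ a ⟧ g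
  ⟦⟧-∼ a f∼g n n≤N = ⟦⟧-causal a n λ m m≤n → f∼g m (ℕ.≤-trans m≤n n≤N)

  ∼-setoid : Setoid 0ℓ 0ℓ
  ∼-setoid = record
    { Carrier       = ℕ → ℤ
    ; _≈_           = _∼_
    ; isEquivalence = record
      { refl  = λ n _ → ≡.refl
      ; sym   = λ p n n≤N → ≡.sym (p n n≤N)
      ; trans = λ p r n n≤N → ≡.trans (p n n≤N) (r n n≤N)
      }
    }

  ≃-isEquivalence : IsEquivalence _≃_
  ≃-isEquivalence = record
    { refl  = mk≃ λ f n _ → ≡.refl
    ; sym   = λ p → mk≃ λ f n n≤N → ≡.sym (apply p f n n≤N)
    ; trans = λ p r → mk≃ λ f n n≤N → ≡.trans (apply p f n n≤N) (apply r f n n≤N)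
    }

  commutativeSemiring : CommutativeSemiring 0ℓ 0ℓ
  commutativeSemiring = record
    { Carrier = Op
    ; _≈_     = _≃_
    ; _+_     = _⊕_
    ; _*_     = _⊗_
    ; 0#      = 𝟘
    ; 1#      = 𝟙
    ; isCommutativeSemiring = isCommutativeSemiringˡ record
      { +-isCommutativeMonoid = isCommutativeMonoidˡ record
        { isSemigroup = record
          { isMagma = record
            { isEquivalence = ≃-isEquivalence
            ; ∙-cong        = λ p r → mk≃ λ f n n≤N → ≡.cong₂ ℤ._+_ (apply p f n n≤N) (apply r f n n≤N)
            }
          ; assoc = λ a b c → mk≃ λ f n _ → ℤ.+-assoc (⟦ a ⟧ f n) (⟦ b ⟧ f n) (⟦ c ⟧ f n)
          }
        ; identityˡ = λ a → mk≃ λ f n _ → ℤ.+-identityˡ (⟦ a ⟧ f n)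
        ; comm      = λ a b → mk≃ λ f n _ → ℤ.+-comm (⟦ a ⟧ f n) (⟦ b ⟧ f n)
        }
      ; *-isCommutativeMonoid = isCommutativeMonoidˡ record
        { isSemigroup = record
          { isMagma = record
            { isEquivalence = ≃-isEquivalence
            ; ∙-cong        = λ {a} {a′} {b} p r → mk≃ λ f n n≤N →
                ≡.trans (apply p (⟦ b ⟧ f) n n≤N) (⟦⟧-∼ a′ (apply r f) n n≤N)
            }
          ; assoc = λ a b c → mk≃ λ f n _ → ≡.refl
          }
        ; identityˡ = λ a → mk≃ λ f n _ → ≡.refl
        ; comm      = λ a b → mk≃ λ f n _ → ⟦⟧-comm a b f n
        }
      ; distribʳ = λ a b c → mk≃ λ f n _ → ≡.refl
      ; zeroˡ    = λ a → mk≃ λ f n _ → ≡.refl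
      }
    }

  open CommutativeSemiring commutativeSemiring public using (_+_; _*_; +-cong; 1#; 0#; _≈_; refl; sym; trans; *-comm; *-identityʳ; *-cong; *-congʳ; *-congˡ; +-congˡ)
  open import Algebra.Properties.CommutativeSemiring.Exp commutativeSemiring public using (_^_; ^-congʳ)

  𝕢^-< : ∀ m f {n} → n ℕ.< m → ⟦ 𝕢 ^ m ⟧ f n ≡ + 0
  𝕢^-< (suc m) f {zero}  _         = ≡.refl
  𝕢^-< (suc m) f {suc n} (s≤s n<m) = 𝕢^-< m f n<m

  𝕢^-+ : ∀ m f n → ⟦ 𝕢 ^ m ⟧ f (m ℕ.+ n) ≡ f n
  𝕢^-+ zero    f n = ≡.refl
  𝕢^-+ (suc m) f n = 𝕢^-+ m f n

  𝕢^≈0 : ∀ m → suc N ℕ.≤ m → 𝕢 ^ m ≈ 0#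
  𝕢^≈0 m N<m = mk≃ λ f n n≤N → 𝕢^-< m f (ℕ.≤-trans (s≤s n≤N) N<m)

  1+𝕥≈0 : 1# + 𝕥 ≈ 0#
  1+𝕥≈0 = mk≃ λ f n _ → ℤ.+-inverseʳ (f n)

  open Theta commutativeSemiring public using (∏; ∏-*; ∏-cong)
  open Theta.Truncated.Signed commutativeSemiring 𝕢 N 𝕢^≈0 𝕥 1+𝕥≈0 public

  -- The operator is f ↦ f + q w f, and the n-th term of q w f depends only on terms of f before n;
  -- strong induction recovers f term by term.
  unipotent-injective : ∀ {a} → Unipotent a → ∀ {f g} → ⟦ a ⟧ f ∼ ⟦ a ⟧ g → f ∼ g
  unipotent-injective {a} (w , a≈) {f} {g} af∼ag n n≤N = below n n≤N n ℕ.≤-refl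
    where
    here : ∀ n → n ℕ.≤ N → ⟦ 𝕢 ⟧ (⟦ w ⟧ f) n ≡ ⟦ 𝕢 ⟧ (⟦ w ⟧ g) n → f n ≡ g n
    here n n≤N eq = ∙-cancelʳ (⟦ 𝕢 ⟧ (⟦ w ⟧ g) n) (f n) (g n) (≡.trans
      (≡.cong (λ x → f n ℤ.+ x) (≡.sym eq))
      (≡.trans (≡.sym (apply a≈ f n n≤N)) (≡.trans (af∼ag n n≤N) (apply a≈ g n n≤N))))
    below : ∀ n → n ℕ.≤ N → ∀ m → m ℕ.≤ n → f m ≡ g m
    below zero    n≤N zero z≤n = here 0 n≤N ≡.refl
    below (suc n) n<N m m≤sn with ℕ.m≤n⇒m<n∨m≡n m≤sn
    ... | inj₁ (s≤s m≤n) = below n (ℕ.<⇒≤ n<N) m m≤n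
    ... | inj₂ ≡.refl    = here (suc n) n<N (⟦⟧-causal w n (below n (ℕ.<⇒≤ n<N)))

  -- Denominators of generating functions as operators

  factor : PartSet → ℕ → Op
  factor S k = if S k then 1# + 𝕥 * 𝕢 ^ k else 1#

  denominator : PartSet → ℕ → Op
  denominator S k = ∏ k (λ i → factor S (suc i))

  unipotent-denominator : ∀ S k → Unipotent (denominator S k)
  unipotent-denominator S k = unipotent-∏ k λ i → unipotent-factor i
    where
    unipotent-factor : ∀ i → Unipotent (factor S (suc i))
    unipotent-factor i with S (suc i)
    ... | true  = 𝕥 * 𝕢 ^ i , +-congˡ (mk≃ λ f n _ → ⟦⟧-comm 𝕥 𝕢 (⟦ 𝕢 ^ i ⟧ f) n)
    ... | false = 0# , mk≃ λ f → λ { zero _ → ≡.sym (ℤ.+-identityʳ (f 0)) ; (suc n) _ → ≡.sym (ℤ.+-identityʳ (f (suc n))) }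

  ∏-1 : ∀ n → ∏ n (λ _ → 1#) ≈ 1#
  ∏-1 zero    = refl
  ∏-1 (suc n) = trans (*-identityʳ _) (∏-1 n)

  ∏-swap : ∀ m n (f : ℕ → ℕ → Op) → ∏ m (λ i → ∏ n (f i)) ≈ ∏ n (λ j → ∏ m (λ i → f i j))
  ∏-swap zero    n f = sym (∏-1 n)
  ∏-swap (suc m) n f = trans (*-congʳ {∏ n (f m)} (∏-swap m n f)) (sym (∏-* n (λ j → ∏ m (λ i → f i j)) (f m)))

  ∏-+ : ∀ m n f → ∏ (m ℕ.+ n) f ≈ ∏ n f * ∏ m (λ i → f (i ℕ.+ n))
  ∏-+ zero    n f = sym (*-identityʳ _)
  ∏-+ (suc m) n f = trans (*-congʳ {f (m ℕ.+ n)} (∏-+ m n f)) (mk≃ λ _ _ _ → ≡.refl)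

  ∏-blocks : ∀ m n f → ∏ (m ℕ.* n) f ≈ ∏ m (λ i → ∏ n (λ j → f (j ℕ.+ i ℕ.* n)))
  ∏-blocks zero    n f = refl
  ∏-blocks (suc m) n f = trans (∏-+ n (m ℕ.* n) f) (*-congʳ (∏-blocks m n f))

  ∏-residues : ∀ S n → ∏ n (λ r → if S (suc r) then E (suc r) else 1#) ≈ ∏E (residues S n)
  ∏-residues S zero    = refl
  ∏-residues S (suc n) with S (suc n)
  ... | true  = trans (*-comm (∏ n (λ r → if S (suc r) then E (suc r) else 1#)) (E (suc n)))
                      (*-congˡ {E (suc n)} (∏-residues S n))
  ... | false = trans (*-identityʳ _) (∏-residues S n)

  -- The first 48(N + 1) factors form N + 1 blocks of length 48. Exchanging the two products
  -- collects each residue r into the N + 1 factors of `E r`.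
  denominator-residues : ∀ S → (∀ r i → S (r ℕ.+ i ℕ.* 48) ≡ S r) →
                         denominator S (suc N ℕ.* 48) ≈ ∏E (residues S 48)
  denominator-residues S periodic =
    trans (∏-blocks (suc N) 48 (λ k → factor S (suc k)))
    (trans (∏-cong (suc N) {λ i → ∏ 48 (λ r → factor S (suc r ℕ.+ i ℕ.* 48))} {λ i → ∏ 48 (blockFactor i)}
      λ i → ∏-cong 48 {λ r → factor S (suc r ℕ.+ i ℕ.* 48)} {blockFactor i} (block i))
    (trans (∏-swap (suc N) 48 blockFactor)
    (trans (∏-cong 48 {λ r → ∏ (suc N) (λ i → blockFactor i r)} {λ r → if S (suc r) then E (suc r) else 1#} collect)
    (∏-residues S 48))))
    where
    blockFactor : ℕ → ℕ → Op
    blockFactor i r = if S (suc r) then 1# + 𝕥 * 𝕢 ^ (suc r ℕ.+ i ℕ.* 48) else 1#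
    block : ∀ i r → factor S (suc (r ℕ.+ i ℕ.* 48)) ≈ blockFactor i r
    block i r rewrite periodic (suc r) i = refl
    collect : ∀ r → ∏ (suc N) (λ i → blockFactor i r) ≈ (if S (suc r) then E (suc r) else 1#)
    collect r with S (suc r)
    ... | true  = refl
    ... | false = ∏-1 (suc N)

-- Generating functions of partitions

sumUpTo-cong : ∀ n {f g} → (∀ i → f i ≡ g i) → sumUpTo n f ≡ sumUpTo n g
sumUpTo-cong zero    f≡g = f≡g 0
sumUpTo-cong (suc n) f≡g = ≡.cong₂ ℕ._+_ (sumUpTo-cong n f≡g) (f≡g (suc n))

sumUpTo-head : ∀ n f → sumUpTo (suc n) f ≡ f 0 ℕ.+ sumUpTo n (λ i → f (suc i))
sumUpTo-head zero    f = ≡.refl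
sumUpTo-head (suc n) f = ≡.trans (≡.cong (ℕ._+ f (suc (suc n))) (sumUpTo-head n f)) (ℕ.+-assoc (f 0) _ _)

sumUpTo-extend : ∀ k n f → (∀ i → n ℕ.< i → f i ≡ 0) → sumUpTo (k ℕ.+ n) f ≡ sumUpTo n f
sumUpTo-extend zero    n f f≡0 = ≡.refl
sumUpTo-extend (suc k) n f f≡0 = ≡.trans
  (≡.cong₂ ℕ._+_ (sumUpTo-extend k n f f≡0) (f≡0 (suc (k ℕ.+ n)) (s≤s (ℕ.m≤n+m n k))))
  (ℕ.+-identityʳ _)

module _ (S : PartSet) (k : ℕ) where

  withPart : ℕ → ℕ → ℕ
  withPart n m = if ⌊ m ≤? n ⌋ then pBounded S k (n ℕ.∸ m) else 0

  withPart-+ : ∀ l n m → withPart (l ℕ.+ n) (l ℕ.+ m) ≡ withPart n m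
  withPart-+ l n m with m ≤? n | l ℕ.+ m ≤? l ℕ.+ n
  ... | yes _   | yes _   = ≡.cong (pBounded S k) (ℕ.[m+n]∸[m+o]≡n∸o l n m)
  ... | yes m≤n | no  ¬p  = contradiction (ℕ.+-monoʳ-≤ l m≤n) ¬p
  ... | no  ¬p  | yes p   = contradiction (ℕ.+-cancelˡ-≤ l m n p) ¬p
  ... | no  _   | no  _   = ≡.refl

  withPart-> : ∀ n m → n ℕ.< m → withPart n m ≡ 0
  withPart-> n m n<m with m ≤? n
  ... | yes m≤n = contradiction m≤n (ℕ.<⇒≱ n<m)
  ... | no  _   = ≡.refl

  summand : ℕ → ℕ → ℕ
  summand n j = withPart n (suc k ℕ.* j)

  summand-0 : ∀ n → summand n 0 ≡ pBounded S k n
  summand-0 n rewrite ℕ.*-zeroʳ k = ≡.refl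

  summand-> : ∀ n j → n ℕ.< suc k ℕ.* j → summand n j ≡ 0
  summand-> n j = withPart-> n (suc k ℕ.* j)

  summand-+ : ∀ n j → summand (suc k ℕ.+ n) (suc j) ≡ summand n j
  summand-+ n j = ≡.trans (≡.cong (withPart (suc k ℕ.+ n)) (ℕ.*-suc (suc k) j))
                          (withPart-+ (suc k) n (suc k ℕ.* j))

  module _ (k∈S : S (suc k) ≡ true) where

    pBounded-suc : ∀ n → pBounded S (suc k) n ≡ sumUpTo n (summand n)
    pBounded-suc n rewrite k∈S = ≡.refl

    pBounded-suc-< : ∀ n → n ℕ.< suc k → pBounded S (suc k) n ≡ pBounded S k n
    pBounded-suc-< n n<k = begin
      pBounded S (suc k) n         ≡⟨ pBounded-suc n ⟩
      sumUpTo n (summand n)        ≡⟨ ≡.cong (λ m → sumUpTo m (summand n)) (ℕ.+-identityʳ n) ⟨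
      sumUpTo (n ℕ.+ 0) (summand n) ≡⟨ sumUpTo-extend n 0 (summand n) (λ j 0<j → summand-> n j (large j 0<j)) ⟩
      summand n 0                  ≡⟨ summand-0 n ⟩
      pBounded S k n               ∎
      where
      open ≡.≡-Reasoning
      large : ∀ j → 0 ℕ.< j → n ℕ.< suc k ℕ.* j
      large (suc j) _ = ℕ.≤-trans n<k (ℕ.m≤m*n (suc k) (suc j))

    -- Either the part k + 1 does not occur, or one copy of it can be removed.
    pBounded-suc-+ : ∀ n → pBounded S (suc k) (suc k ℕ.+ n) ≡ pBounded S k (suc k ℕ.+ n) ℕ.+ pBounded S (suc k) n
    pBounded-suc-+ n = begin
      pBounded S (suc k) m
        ≡⟨ pBounded-suc m ⟩
      sumUpTo m (summand m)
        ≡⟨ sumUpTo-head (k ℕ.+ n) (summand m) ⟩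
      summand m 0 ℕ.+ sumUpTo (k ℕ.+ n) (λ j → summand m (suc j))
        ≡⟨ ≡.cong₂ ℕ._+_ (summand-0 m) (sumUpTo-cong (k ℕ.+ n) (summand-+ n)) ⟩
      pBounded S k m ℕ.+ sumUpTo (k ℕ.+ n) (summand n)
        ≡⟨ ≡.cong (pBounded S k m ℕ.+_) (sumUpTo-extend k n (summand n)
             (λ j n<j → summand-> n j (ℕ.≤-trans n<j (ℕ.m≤m+n j (k ℕ.* j))))) ⟩
      pBounded S k m ℕ.+ sumUpTo n (summand n)
        ≡⟨ ≡.cong (pBounded S k m ℕ.+_) (pBounded-suc n) ⟨
      pBounded S k m ℕ.+ pBounded S (suc k) n
        ∎
      where
      open ≡.≡-Reasoning
      m = suc k ℕ.+ n

pBounded-stable : ∀ S {k n} → n ℕ.≤ k → pBounded S k n ≡ p S n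
pBounded-stable S {k} {n} n≤k with ℕ.m≤n⇒m<n∨m≡n n≤k
... | inj₂ ≡.refl = ≡.refl
pBounded-stable S {suc k} {n} n≤k | inj₁ n<k with S (suc k) in eq
-- Matching on `S (suc k)` has unfolded `pBounded` into its sum; `pBounded-suc` folds it back.
... | true  = ≡.trans (≡.trans (≡.sym (pBounded-suc S k eq n)) (pBounded-suc-< S k eq n n<k)) (pBounded-stable S (ℕ.≤-pred n<k))
... | false = pBounded-stable S (ℕ.≤-pred n<k)

pmResidues-periodic : ∀ rs r i → pmResidues 48 rs (r ℕ.+ i ℕ.* 48) ≡ pmResidues 48 rs r
pmResidues-periodic rs r i =
  ≡.cong (λ x → any (λ s → ⌊ x ℕ.≟ s ℕ.% 48 ⌋ ∨ ⌊ x ℕ.≟ (48 ℕ.∸ s ℕ.% 48) ℕ.% 48 ⌋) rs) ([m+kn]%n≡m%n r i 48)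

δ : ℕ → ℤ
δ zero    = + 1
δ (suc n) = + 0

module Generating (N : ℕ) where
  open Truncation N
  open import Relation.Binary.Reasoning.Setoid ∼-setoid

  bounded : PartSet → ℕ → ℕ → ℤ
  bounded S k n = + pBounded S k n

  -- The factor 1 - q^(k+1) undoes the admission of the part k + 1; below k + 1 its shifted term is
  -- zero, and from there on the recurrence cancels it.
  factor-bounded : ∀ S k n → ⟦ factor S (suc k) ⟧ (bounded S (suc k)) n ≡ bounded S k n
  factor-bounded S k n with S (suc k) in eq
  ... | false = ≡.refl
  ... | true  with ℕ.≤-<-connex (suc k) n
  ...   | inj₂ n<k = ≡.trans
    (≡.cong₂ (λ x y → x ℤ.+ ℤ.- y) (≡.cong +_ (≡.trans (≡.sym (pBounded-suc S k eq n)) (pBounded-suc-< S k eq n n<k)))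
      (𝕢^-< (suc k) _ n<k))
    (ℤ.+-identityʳ _)
  ...   | inj₁ k≤n with ℕ.m≤n⇒∃[o]m+o≡n k≤n
  ...     | m , ≡.refl = ≡.trans
    (≡.cong₂ (λ x y → x ℤ.+ ℤ.- y)
      (≡.cong +_ (≡.trans (≡.sym (pBounded-suc S k eq (suc k ℕ.+ m))) (pBounded-suc-+ S k eq m)))
      (≡.trans (𝕢^-+ (suc k) _ m) (≡.cong +_ (≡.sym (pBounded-suc S k eq m)))))
    (cancel (bounded S k (suc k ℕ.+ m)) (bounded S (suc k) m))
    where
    cancel : ∀ x y → x ℤ.+ y ℤ.- y ≡ x
    cancel x y = ≡.trans (ℤ.+-assoc x y (ℤ.- y)) (≡.trans (≡.cong (λ z → x ℤ.+ z) (ℤ.+-inverseʳ y)) (ℤ.+-identityʳ x))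

  denominator-bounded : ∀ S k n → ⟦ denominator S k ⟧ (bounded S k) n ≡ δ n
  denominator-bounded S zero    zero    = ≡.refl
  denominator-bounded S zero    (suc n) = ≡.refl
  denominator-bounded S (suc k) n       =
    ≡.trans (⟦⟧-cong (denominator S k) (factor-bounded S k) n) (denominator-bounded S k n)

-- The four sets, and comparison of coefficients

s₁ t₁ s₂ t₂ : List ℕ
s₁ = 1 ∷ 4 ∷ 5 ∷ 6 ∷ 7 ∷ 9 ∷ 15 ∷ 17 ∷ 19 ∷ 20 ∷ 22 ∷ 23 ∷ []
t₁ = 1 ∷ 3 ∷ 4 ∷ 5 ∷ 11 ∷ 13 ∷ 14 ∷ 18 ∷ 19 ∷ 20 ∷ 21 ∷ 23 ∷ []
s₂ = 2 ∷ 3 ∷ 4 ∷ 5 ∷ 7 ∷ 11 ∷ 13 ∷ 17 ∷ 18 ∷ 19 ∷ 20 ∷ 21 ∷ []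
t₂ = 1 ∷ 4 ∷ 6 ∷ 7 ∷ 9 ∷ 10 ∷ 11 ∷ 13 ∷ 15 ∷ 17 ∷ 20 ∷ 23 ∷ []

S₁ T₁ S₂ T₂ : PartSet
S₁ = pmResidues 48 s₁
T₁ = pmResidues 48 t₁
S₂ = pmResidues 48 s₂
T₂ = pmResidues 48 t₂

residues-S₁ : residues S₁ 48 ≡ S₁-residues
residues-S₁ = ≡.refl

residues-T₁ : residues T₁ 48 ≡ T₁-residues
residues-T₁ = ≡.refl

residues-S₂ : residues S₂ 48 ≡ S₂-residues
residues-S₂ = ≡.refl

residues-T₂ : residues T₂ 48 ≡ T₂-residues
residues-T₂ = ≡.refl

module Conclude (N : ℕ) where
  open Truncation N
  open Generating N
  open import Relation.Binary.Reasoning.Setoid ∼-setoid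

  K : ℕ
  K = suc N ℕ.* 48

  D : PartSet → Op
  D S = denominator S K

  count : PartSet → ℕ → ℤ
  count S n = + p S n

  D-count : ∀ S → ⟦ D S ⟧ (count S) ∼ δ
  D-count S = begin
    ⟦ D S ⟧ (count S)      ≈⟨ ⟦⟧-∼ (D S) (λ n n≤N → ≡.cong +_ (pBounded-stable S (ℕ.≤-trans n≤N N≤K))) ⟨
    ⟦ D S ⟧ (bounded S K)  ≈⟨ (λ n _ → denominator-bounded S K n) ⟩
    δ                      ∎
    where
    N≤K : N ℕ.≤ K
    N≤K = ℕ.≤-trans (ℕ.n≤1+n N) (ℕ.m≤m*n (suc N) 48)

  -- The hypothesis is 1/D S = q/D T + 1 with denominators cleared. Applied to `δ`, it shows that
  -- `D S * D T` takes the same value on `count S` and on the shifted `count T` plus `δ`, and this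
  -- operator is injective.
  shifted : ∀ S T → D T ≈ 𝕢 * D S + D S * D T → ∀ n → suc n ℕ.≤ N → p S (suc n) ≡ p T n
  shifted S T eq n n<N = ℤ.+-injective (≡.trans
    (unipotent-injective (unipotent-* (unipotent-denominator S K) (unipotent-denominator T K)) identity (suc n) n<N)
    (ℤ.+-identityʳ (count T n)))
    where
    identity : ⟦ D S * D T ⟧ (count S) ∼ ⟦ D S * D T ⟧ (λ m → shift (count T) m ℤ.+ δ m)
    identity = begin
      ⟦ D S ⟧ (⟦ D T ⟧ (count S))
        ≈⟨ (λ m _ → ⟦⟧-comm (D S) (D T) (count S) m) ⟩
      ⟦ D T ⟧ (⟦ D S ⟧ (count S))
        ≈⟨ ⟦⟧-∼ (D T) (D-count S) ⟩
      ⟦ D T ⟧ δ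
        ≈⟨ apply eq δ ⟩
      ⟦ 𝕢 * D S + D S * D T ⟧ δ
        ≈⟨ (λ m m≤N → ≡.cong (ℤ._+ ⟦ D S * D T ⟧ δ m) (shifted-D m m≤N)) ⟨
      (λ m → ⟦ D S * D T ⟧ (shift (count T)) m ℤ.+ ⟦ D S * D T ⟧ δ m)
        ≈⟨ (λ m _ → ⟦⟧-+ (D S * D T) (shift (count T)) δ m) ⟨
      ⟦ D S * D T ⟧ (λ m → shift (count T) m ℤ.+ δ m)
        ∎
      where
      shifted-D : ⟦ D S * D T ⟧ (shift (count T)) ∼ ⟦ 𝕢 * D S ⟧ δ
      shifted-D = begin
        ⟦ D S * D T ⟧ (shift (count T))   ≈⟨ (λ m _ → ⟦⟧-shift (D S * D T) (count T) m) ⟩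
        ⟦ 𝕢 * D S ⟧ (⟦ D T ⟧ (count T))   ≈⟨ ⟦⟧-∼ (𝕢 * D S) (D-count T) ⟩
        ⟦ 𝕢 * D S ⟧ δ                     ∎

  -- The hypothesis is 1/D T = 1/D S + q with denominators cleared, so `count T` is `count S` plus
  -- `shift δ`; the latter is the series q, whose only nonzero coefficient is at the excluded n = 1.
  shiftless : ∀ S T → D T + 𝕢 * (D S * D T) ≈ D S → ∀ n → n ≢ 1 → n ℕ.≤ N → p S n ≡ p T n
  shiftless S T eq n n≢1 n≤N = ℤ.+-injective (≡.sym (≡.trans
    (unipotent-injective (unipotent-* (unipotent-denominator S K) (unipotent-denominator T K)) identity n n≤N)
    (≡.trans (≡.cong (λ x → count S n ℤ.+ x) (shift-δ n n≢1)) (ℤ.+-identityʳ (count S n)))))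
    where
    shift-δ : ∀ n → n ≢ 1 → shift δ n ≡ + 0
    shift-δ zero          n≢1 = ≡.refl
    shift-δ (suc zero)    n≢1 = contradiction ≡.refl n≢1
    shift-δ (suc (suc n)) n≢1 = ≡.refl
    identity : ⟦ D S * D T ⟧ (count T) ∼ ⟦ D S * D T ⟧ (λ m → count S m ℤ.+ shift δ m)
    identity = begin
      ⟦ D S ⟧ (⟦ D T ⟧ (count T))
        ≈⟨ ⟦⟧-∼ (D S) (D-count T) ⟩
      ⟦ D S ⟧ δ
        ≈⟨ apply eq δ ⟨
      (λ m → ⟦ D T ⟧ δ m ℤ.+ shift (⟦ D S * D T ⟧ δ) m)
        ≈⟨ (λ m m≤N → ≡.cong₂ ℤ._+_ (D-S m m≤N) (⟦⟧-shift (D S * D T) δ m)) ⟨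
      (λ m → ⟦ D S * D T ⟧ (count S) m ℤ.+ ⟦ D S * D T ⟧ (shift δ) m)
        ≈⟨ (λ m _ → ⟦⟧-+ (D S * D T) (count S) (shift δ) m) ⟨
      ⟦ D S * D T ⟧ (λ m → count S m ℤ.+ shift δ m)
        ∎
      where
      D-S : ⟦ D S * D T ⟧ (count S) ∼ ⟦ D T ⟧ δ
      D-S = begin
        ⟦ D S ⟧ (⟦ D T ⟧ (count S))   ≈⟨ (λ m _ → ⟦⟧-comm (D S) (D T) (count S) m) ⟩
        ⟦ D T ⟧ (⟦ D S ⟧ (count S))   ≈⟨ ⟦⟧-∼ (D T) (D-count S) ⟩
        ⟦ D T ⟧ δ                     ∎

  D-∏E : ∀ rs es → residues (pmResidues 48 rs) 48 ≡ es → D (pmResidues 48 rs) ≈ ∏E es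
  D-∏E rs _ ≡.refl = denominator-residues (pmResidues 48 rs) (pmResidues-periodic rs)

  D-S₁ : D S₁ ≈ ∏E S₁-residues
  D-S₁ = D-∏E s₁ S₁-residues residues-S₁

  D-T₁ : D T₁ ≈ ∏E T₁-residues
  D-T₁ = D-∏E t₁ T₁-residues residues-T₁

  D-S₂ : D S₂ ≈ ∏E S₂-residues
  D-S₂ = D-∏E s₂ S₂-residues residues-S₂

  D-T₂ : D T₂ ≈ ∏E T₂-residues
  D-T₂ = D-∏E t₂ T₂-residues residues-T₂

  relation₁ : D T₁ ≈ 𝕢 * D S₁ + D S₁ * D T₁
  relation₁ = trans D-T₁ (trans denominators₁ (sym (+-cong (*-congˡ {𝕢} D-S₁) (*-cong D-S₁ D-T₁))))

  relation₂ : D T₂ + 𝕢 * (D S₂ * D T₂) ≈ D S₂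
  relation₂ = trans (+-cong D-T₂ (*-congˡ {𝕢} (*-cong D-S₂ D-T₂))) (trans denominators₂ (sym D-S₂))

theorem7p2 : ((n : ℕ) →
    p (pmResidues 48 (1 ∷ 4 ∷ 5 ∷ 6 ∷ 7 ∷ 9 ∷ 15 ∷ 17 ∷ 19 ∷ 20 ∷ 22 ∷ 23 ∷ [])) (suc n)
    ≡ p (pmResidues 48 (1 ∷ 3 ∷ 4 ∷ 5 ∷ 11 ∷ 13 ∷ 14 ∷ 18 ∷ 19 ∷ 20 ∷ 21 ∷ 23 ∷ [])) n)
    ×
    ((n : ℕ) → n ≢ 1 →
    p (pmResidues 48 (2 ∷ 3 ∷ 4 ∷ 5 ∷ 7 ∷ 11 ∷ 13 ∷ 17 ∷ 18 ∷ 19 ∷ 20 ∷ 21 ∷ [])) n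
    ≡ p (pmResidues 48 (1 ∷ 4 ∷ 6 ∷ 7 ∷ 9 ∷ 10 ∷ 11 ∷ 13 ∷ 15 ∷ 17 ∷ 20 ∷ 23 ∷ [])) n)
theorem7p2 =
  -- The truncation is chosen afresh for each n, just large enough to retain the coefficient of
  -- q^(n+1).
  (λ n → let open Conclude (suc n) in shifted S₁ T₁ relation₁ n ℕ.≤-refl) ,
  (λ n n≢1 → let open Conclude n in shiftless S₂ T₂ relation₂ n n≢1 ℕ.≤-refl)
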